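{- Let $s>2$ and $t>3$ be integers and let $G=C_{s,t}$ be the comet network of order $s+t$, with nodes $v_1,\ldots,v_{t-1},c,u_1,\ldots,u_s$. Then, for $v\in V(G)$, $$IMC(v)=\begin{cases} \dfrac{2t(3s^2-6s+3st-3t+t^2+2)-6s(s-1)}{\big(t(t+1)(t+3s-1)+6s(s-1)\big)(s+t-2)}, & \text{if } v=v_1;\\[3mm] \dfrac{12st(s+t-3)+2t(2t-5)(t-2)-6(3s-1)(s-1)}{(s+t-3)\big(t(t+1)(t+3s-1)+6s(s-1)\big)}, & \text{if } v=v_i\ (2\le i\le t-1);\\[3mm] \dfrac{2\big(t(s(t+2)+t-1)+3s(s-1)\big)}{t(t+1)(t+3s-1)+6s(s-1)}, & \text{if } v=c;\\[3mm] \dfrac{2t(t^2+6s-7)+6(s-1)(s-2)}{(s+t-2)\big(t(t+1)(t+3s-1)+6s(s-1)\big)}, & \text{if } v=u_j\ (1\le j\le s). \end{cases}$$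
   Context: All graphs are finite, simple and undirected. The order of a graph is its number of nodes; $d_{uv}$ denotes the length of a shortest path between nodes $u$ and $v$. For a connected graph $H$ of order $m\ge 2$, the agglomeration is $$\phi(H)=\frac{m-1}{\sum_{u,v\in V(H),\,u\ne v} d_{uv}},$$ where the sum is over all ordered pairs $(u,v)$ of distinct nodes (equivalently $\phi(H)=1/(mL(H))$, where $L(H)=\frac{1}{m(m-1)}\sum_{u\neq v}d_{uv}$ is the average path length); if $m=1$, then $\phi(H)=1$. For a node $v$ of a graph $G$, the node contraction $G'(v)$ is the simple graph obtained from $G$ by replacing $v$ together with all its $\deg(v)$ neighbors (these $\deg(v)+1$ nodes) by one new node $v'$, which is adjacent to every remaining node that was adjacent in $G$ to at least one of the replaced nodes; adjacency among the remaining nodes is unchanged. The importance of $v$ in $G$ is $$IMC(v)=1-\frac{\phi(G)}{\phi(G'(v))}.$$ For positive integers $s,t$, the comet $C_{s,t}$ is the tree obtained by identifying the center of the star $K_{1,s}$ with an end-node of the path $P_t$ of order $t$. The identified node is called $c$; the nodes of $P_t$ are labelled sequentially along the path as $v_1,v_2,\ldots,v_{t-1},c$ (so $v_1$ is the other end-node of $P_t$), and the leaves of $K_{1,s}$ (all adjacent to $c$) are $u_1,\ldots,u_s$. -}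

module Defs where

open import Data.Bool using (if_then_else_)
open import Data.Empty using (⊥; ⊥-elim-irr)
open import Data.Fin using (Fin; toℕ)
import Data.Fin.Properties as Fin
open import Data.Integer as ℤ using (ℤ; +_)
open import Data.List using (List; []; _∷_; _++_; map; filter; find; length; upTo; allFin)
open import Data.List.Membership.Propositional using (_∈_; lose)
open import Data.List.Membership.Propositional.Properties using (∈-map⁺; ∈-map⁻; ∈-++⁺ˡ; ∈-++⁺ʳ; ∈-allFin)
open import Data.List.Relation.Unary.All as All using (All; []; _∷_)
open import Data.List.Relation.Unary.AllPairs using ([]; _∷_)
open import Data.List.Relation.Unary.Any as Any using (here; there)
open import Data.List.Relation.Unary.Unique.Propositional using (Unique)
import Data.List.Relation.Unary.Unique.Propositional.Properties as Unique
open import Data.Maybe using (fromMaybe)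
open import Data.Nat as ℕ using (ℕ; zero; suc)
open import Data.Nat.ListAction using (sum)
import Data.Nat.Properties as ℕ
open import Data.Product using (∃; _×_; _,_)
open import Data.Rational as ℚ using (ℚ; 0ℚ; 1ℚ; ≢-nonZero)
open import Data.Sum using (_⊎_; inj₁; inj₂)
open import Data.Vec as Vec using (Vec; []; _∷_)
import Data.Vec.Relation.Unary.AllPairs as VecAllPairs
open import Data.Vec.Relation.Unary.Linked using (Linked; linked?)
import Data.Vec.Relation.Unary.Unique.Propositional as VecUnique
open import Level using (0ℓ)
open import Relation.Binary using (Rel; Symmetric; Irreflexive; Decidable; DecidableEquality)
open import Relation.Binary.Construct.Closure.Symmetric using (SymClosure; fwd; bwd; symmetric)
open import Relation.Binary.PropositionalEquality using (_≡_; _≢_; refl; sym; cong; subst)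
open import Relation.Nullary using (¬_; Dec; yes; no; does; ¬?)
open import Relation.Nullary.Decidable using (map′; _×-dec_; _⊎-dec_)
import Relation.Unary as U

-- Total division on ℚ; the value at a zero denominator is a convention.

infixl 7 _÷₀_ _//_

_÷₀_ : ℚ → ℚ → ℚ
p ÷₀ q with q ℚ.≟ 0ℚ
... | yes _   = 0ℚ
... | no  q≢0 = (p ℚ.÷ q) {{≢-nonZero q≢0}}

_//_ : ℤ → ℤ → ℚ
i // j = (i ℚ./ 1) ÷₀ (j ℚ./ 1)

record Graph : Set₁ where
  infix 4 _~_ _~?_ _≟_
  field
    Node     : Set
    _≟_      : DecidableEquality Node
    nodes    : List Node
    complete : ∀ x → x ∈ nodes
    unique   : Unique nodes
    _~_      : Rel Node 0ℓ
    _~?_     : Decidable _~_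
    ~-sym    : Symmetric _~_
    ~-irrefl : Irreflexive _≡_ _~_

  order : ℕ
  order = length nodes

  anyNode? : {P : U.Pred Node 0ℓ} → U.Decidable P → Dec (∃ P)
  anyNode? P? = map′ Any.satisfied (λ (x , px) → lose (complete x) px) (Any.any? P? nodes)

  anyVec? : ∀ {k} {P : U.Pred (Vec Node k) 0ℓ} → U.Decidable P → Dec (∃ P)
  anyVec? {zero}  P? = map′ ([] ,_) (λ { ([] , p) → p }) (P? [])
  anyVec? {suc k} P? =
    map′ (λ (x , xs , p) → x ∷ xs , p) (λ { (x ∷ xs , p) → x , xs , p })
         (anyNode? (λ x → anyVec? (λ xs → P? (x ∷ xs))))

  -- A path of length k has k edges, hence k + 1 pairwise distinct nodes.
  IsPath : Node → Node → ∀ {k} → Vec Node (suc k) → Set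
  IsPath u v xs = Vec.head xs ≡ u × Vec.last xs ≡ v × Linked _~_ xs × VecUnique.Unique xs

  Path : Node → Node → ℕ → Set
  Path u v k = ∃ (IsPath u v {k})

  path? : ∀ u v → U.Decidable (Path u v)
  path? u v k = anyVec? λ xs →
    (Vec.head xs ≟ u) ×-dec (Vec.last xs ≟ v) ×-dec linked? _~?_ xs
      ×-dec VecAllPairs.allPairs? (λ x y → ¬? (x ≟ y)) xs

  -- The least length of a path from u to v.  Paths have distinct nodes, so
  -- only lengths below the order occur; 0 is a convention for disconnected
  -- pairs.
  dist : Node → Node → ℕ
  dist u v = fromMaybe 0 (find (path? u v) (upTo order))

  totalDist : ℕ
  totalDist = sum (map (λ u → sum (map (dist u) (filter (λ v → ¬? (u ≟ v)) nodes))) nodes)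

-- Agglomeration; only meaningful for connected graphs.
φ : Graph → ℚ
φ G = if does (order ℕ.≟ 1) then 1ℚ else (+ order ℤ.- + 1) // + totalDist
  where open Graph G

module Contraction (G : Graph) (v : Graph.Node G) where
  open Graph G

  Replaced : Node → Set
  Replaced x = x ≡ v ⊎ v ~ x

  replaced? : U.Decidable Replaced
  replaced? x = (x ≟ v) ⊎-dec (v ~? x)

  data CNode : Set where
    new  : CNode
    kept : (x : Node) → .(¬ Replaced x) → CNode

  Touches : Node → Set
  Touches y = ∃ λ x → Replaced x × x ~ y

  touches? : U.Decidable Touches
  touches? y = anyNode? λ x → replaced? x ×-dec (x ~? y)

  CAdj : Rel CNode 0ℓ
  CAdj new        new        = ⊥
  CAdj new        (kept y _) = Touches y
  CAdj (kept x _) new        = Touches x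
  CAdj (kept x _) (kept y _) = x ~ y

  cAdj? : Decidable CAdj
  cAdj? new        new        = no λ ()
  cAdj? new        (kept y _) = touches? y
  cAdj? (kept x _) new        = touches? x
  cAdj? (kept x _) (kept y _) = x ~? y

  cAdj-sym : Symmetric CAdj
  cAdj-sym {new}      {kept _ _} t = t
  cAdj-sym {kept _ _} {new}      t = t
  cAdj-sym {kept _ _} {kept _ _} e = ~-sym e

  cAdj-irrefl : Irreflexive _≡_ CAdj
  cAdj-irrefl {kept _ _} refl e = ~-irrefl refl e

  kept-cong : ∀ {x y} .{p : ¬ Replaced x} .{q : ¬ Replaced y} → x ≡ y → kept x p ≡ kept y q
  kept-cong refl = refl

  _≟ᶜ_ : DecidableEquality CNode
  new      ≟ᶜ new      = yes refl
  new      ≟ᶜ kept _ _ = no λ ()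
  kept _ _ ≟ᶜ new      = no λ ()
  kept x _ ≟ᶜ kept y _ = map′ kept-cong (λ { refl → refl }) (x ≟ y)

  keep : List Node → List CNode
  keep []       = []
  keep (x ∷ xs) with replaced? x
  ... | yes _ = keep xs
  ... | no ¬r = kept x ¬r ∷ keep xs

  ∈-keep : ∀ {x xs} .(¬r : ¬ Replaced x) → x ∈ xs → kept x ¬r ∈ keep xs
  ∈-keep {x} {y ∷ xs} ¬r x∈ with replaced? y | x∈
  ... | yes r | here refl = ⊥-elim-irr (¬r r)
  ... | yes _ | there p   = ∈-keep ¬r p
  ... | no  _ | here refl = here refl
  ... | no  _ | there p   = there (∈-keep ¬r p)

  keep-fresh : ∀ {x xs} .{¬r : ¬ Replaced x} → All (x ≢_) xs → All (kept x ¬r ≢_) (keep xs)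
  keep-fresh {xs = []}     []       = []
  keep-fresh {xs = y ∷ xs} (p ∷ ps) with replaced? y
  ... | yes _ = keep-fresh ps
  ... | no  _ = (λ { refl → p refl }) ∷ keep-fresh ps

  new-fresh : ∀ xs → All (new ≢_) (keep xs)
  new-fresh []       = []
  new-fresh (x ∷ xs) with replaced? x
  ... | yes _ = new-fresh xs
  ... | no  _ = (λ ()) ∷ new-fresh xs

  keep-unique : ∀ {xs} → Unique xs → Unique (keep xs)
  keep-unique {[]}     []       = []
  keep-unique {x ∷ xs} (p ∷ ps) with replaced? x
  ... | yes _ = keep-unique ps
  ... | no  _ = keep-fresh p ∷ keep-unique ps

  contracted : Graph
  contracted = record
    { Node     = CNode
    ; _≟_      = _≟ᶜ_
    ; nodes    = new ∷ keep nodes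
    ; complete = λ { new → here refl ; (kept x ¬r) → there (∈-keep ¬r (complete x)) }
    ; unique   = new-fresh nodes ∷ keep-unique unique
    ; _~_      = CAdj
    ; _~?_     = cAdj?
    ; ~-sym    = λ {x} {y} → cAdj-sym {x} {y}
    ; ~-irrefl = cAdj-irrefl
    }

contract : (G : Graph) → Graph.Node G → Graph
contract = Contraction.contracted

IMC : (G : Graph) → Graph.Node G → ℚ
IMC G v = 1ℚ ℚ.- φ G ÷₀ φ (contract G v)

-- The comet with t ≥ 1: v i is the path node numbered toℕ i + 1, so the
-- numbers run through 1, …, t - 1, and u j is the leaf numbered toℕ j + 1.
data CometNode (s t : ℕ) : Set where
  v : Fin (ℕ.pred t) → CometNode s t
  c : CometNode s t
  u : Fin s → CometNode s t

number : ∀ {n} → Fin n → ℕ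
number i = suc (toℕ i)

module Comet (s t : ℕ) where

  data Edge : Rel (CometNode s t) 0ℓ where
    v-v : ∀ {i j} → number j ≡ suc (number i) → Edge (v i) (v j)
    v-c : ∀ {i} → number i ≡ ℕ.pred t → Edge (v i) c
    c-u : ∀ {j} → Edge c (u j)

  edge? : Decidable Edge
  edge? (v i) (v j) = map′ v-v (λ { (v-v e) → e }) (number j ℕ.≟ suc (number i))
  edge? (v i) c     = map′ v-c (λ { (v-c e) → e }) (number i ℕ.≟ ℕ.pred t)
  edge? (v _) (u _) = no λ ()
  edge? c     (v _) = no λ ()
  edge? c     c     = no λ ()
  edge? c     (u _) = yes c-u
  edge? (u _) _     = no λ ()

  adj? : Decidable (SymClosure Edge)
  adj? x y = map′ (λ { (inj₁ e) → fwd e ; (inj₂ e) → bwd e })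
                  (λ { (fwd e) → inj₁ e ; (bwd e) → inj₂ e })
                  (edge? x y ⊎-dec edge? y x)

  edge-irrefl : ∀ {x} → ¬ Edge x x
  edge-irrefl (v-v e) = ℕ.1+n≢n (sym e)

  adj-irrefl : Irreflexive _≡_ (SymClosure Edge)
  adj-irrefl refl (fwd e) = edge-irrefl e
  adj-irrefl refl (bwd e) = edge-irrefl e

  _≟ⁿ_ : DecidableEquality (CometNode s t)
  v i ≟ⁿ v j = map′ (cong v) (λ { refl → refl }) (i Fin.≟ j)
  v _ ≟ⁿ c   = no λ ()
  v _ ≟ⁿ u _ = no λ ()
  c   ≟ⁿ v _ = no λ ()
  c   ≟ⁿ c   = yes refl
  c   ≟ⁿ u _ = no λ ()
  u _ ≟ⁿ v _ = no λ ()
  u _ ≟ⁿ c   = no λ ()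
  u i ≟ⁿ u j = map′ (cong u) (λ { refl → refl }) (i Fin.≟ j)

  vs us : List (CometNode s t)
  vs = map v (allFin (ℕ.pred t))
  us = map u (allFin s)

  complete : ∀ x → x ∈ vs ++ c ∷ us
  complete (v i) = ∈-++⁺ˡ (∈-map⁺ v (∈-allFin i))
  complete c     = ∈-++⁺ʳ vs (here refl)
  complete (u j) = ∈-++⁺ʳ vs (there (∈-map⁺ u (∈-allFin j)))

  c-fresh : All (c ≢_) us
  c-fresh = All.tabulate λ x∈ c≡x → c≢u (∈-map⁻ u (subst (_∈ us) (sym c≡x) x∈))
    where
    c≢u : ¬ (∃ λ j → j ∈ allFin s × c ≡ u j)
    c≢u (_ , _ , ())

  unique : Unique (vs ++ c ∷ us)
  unique = Unique.++⁺ (Unique.map⁺ (λ { refl → refl }) (Unique.allFin⁺ _))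
                      (c-fresh ∷ Unique.map⁺ (λ { refl → refl }) (Unique.allFin⁺ s))
                      λ (x∈vs , x∈cus) → disjoint (∈-map⁻ v x∈vs) x∈cus
    where
    disjoint : ∀ {x} → (∃ λ i → i ∈ allFin (ℕ.pred t) × x ≡ v i) → ¬ (x ∈ c ∷ us)
    disjoint (_ , _ , refl) (there x∈us) with ∈-map⁻ u x∈us
    ... | _ , _ , ()

comet : ℕ → ℕ → Graph
comet s t = record
  { Node     = CometNode s t
  ; _≟_      = _≟ⁿ_
  ; nodes    = vs ++ c ∷ us
  ; complete = complete
  ; unique   = unique
  ; _~_      = SymClosure Edge
  ; _~?_     = adj?
  ; ~-sym    = symmetric Edge
  ; ~-irrefl = adj-irrefl
  }
  where open Comet s t

module Submission where

-- Number the nodes of the comet C(s,t) by height: 0, …, t - 1 along the path up to c, and t for every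
-- leaf.  Two nodes are adjacent iff their heights differ by one, so the distance is the difference of
-- heights, except that distinct leaves are at distance 2.  Summing gives three times the total distance
-- as t(t+1)(t+3s-1) + 6s(s-1).  A node contraction of C(s,t) is again a comet: C(s,t-1) for v₁, C(s,t-2)
-- for the other vᵢ, the path C(0,t-1) for c, and C(s-1,t) for a leaf.

open import Defs
open import Data.Bool using (if_then_else_)
open import Data.Empty using (⊥-elim-irr)
open import Data.Fin as Fin using (Fin; zero; suc; toℕ; fromℕ<; punchIn; punchOut)
import Data.Fin.Properties as Fin
import Data.Integer as ℤ
import Data.Integer.Properties as ℤ
import Data.Integer.Tactic.RingSolver as ℤSolver
open import Data.List
  using (List; []; _∷_; _∷ʳ_; _++_; map; filter; find; length; lookup; tabulate; allFin; applyUpTo)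
open import Data.List.Membership.Propositional using (_∈_)
open import Data.List.Membership.Propositional.Properties using (∈-map⁺)
open import Data.List.Membership.Propositional.Properties.WithK using (unique∧set⇒bag)
open import Data.List.Properties
  using (map-++; map-∘; map-cong; map-tabulate; tabulate-cong; length-map; length-++; length-tabulate; applyUpTo-∷ʳ)
open import Data.List.Relation.Binary.BagAndSetEquality using (∼bag⇒↭)
open import Data.List.Relation.Binary.Permutation.Propositional using (_↭_)
open import Data.List.Relation.Binary.Permutation.Propositional.Properties using (map⁺; ↭-length)
open import Data.List.Relation.Unary.Any using (index)
open import Data.List.Relation.Unary.Any.Properties using (lookup-index)
import Data.List.Relation.Unary.Unique.Propositional.Properties as Unique
open import Data.Maybe using (just; fromMaybe)
import Data.Nat as ℕ
open import Data.Nat.ListAction using (sum)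
open import Data.Nat.ListAction.Properties using (sum-++; sum-↭)
import Data.Nat.Properties as ℕ
open import Data.Nat.Tactic.RingSolver using (solve-∀)
open import Data.Product using (_×_; _,_; ∃; ∃₂; proj₁; proj₂)
import Data.Rational as ℚ
import Data.Rational.Properties as ℚ
open import Data.Rational.Solver using (module +-*-Solver)
open import Data.Rational.Unnormalised as ℚᵘ using (mkℚᵘ)
import Data.Rational.Unnormalised.Properties as ℚᵘ
open import Data.Sum as Sum using (_⊎_; inj₁; inj₂)
open import Function using (_on_; _∘_)
open import Function.Bundles using (mk⇔)
open import Relation.Binary using (tri<; tri≈; tri>)
open import Relation.Binary.Construct.Closure.Symmetric using (fwd; bwd)
open import Relation.Binary.PropositionalEquality
open import Relation.Nullary using (¬_; Dec; does; yes; no; ¬?; contradiction)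
open import Relation.Unary using (Decidable)

-- `dist` is a search over all vectors of nodes, so nothing about it computes for variable s and t.
-- A candidate distance is therefore certified by local conditions (`IsMetric`): an edge changes it
-- by at most one, and from every node other than the target some edge decreases it. These
-- conditions pull back along isomorphisms, so no distance is ever computed inside a contracted
-- graph. The contracted graphs are recognised as quotients of G, through a surjection whose only
-- nontrivial fibre is the closed neighbourhood of the contracted node. Allowing s = 0 lets the path
-- that arises from c share the distance sum of the comets. What then remains is one polynomial
-- identity in s and t for each formula. Three copies of the total distance are carried along
-- because the sum is a cubic over 3; the factor cancels in the quotient of the two agglomerations.

-- Quotients of integers in the rationals

module RationalQuotients where

  open import Data.Integer using (ℤ; 0ℤ)
  open import Data.Rational using (ℚ; 0ℚ; 1ℚ; ≢-nonZero)

  ι : ℤ → ℚ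
  ι i = i ℚ./ 1

  -- Passing to unnormalised rationals, where sums and products of fractions over 1 involve no gcd,
  -- makes `ι` a ring homomorphism by little more than computation.
  toℚᵘ-ι : ∀ i → ℚ.toℚᵘ (ι i) ℚᵘ.≃ mkℚᵘ i 0
  toℚᵘ-ι i = ℚ.toℚᵘ-fromℚᵘ (mkℚᵘ i 0)

  ι-injective : ∀ {i j} → ι i ≡ ι j → i ≡ j
  ι-injective {i} {j} eq = subst₂ _≡_ (ℤ.*-identityʳ i) (ℤ.*-identityʳ j)
    (ℚᵘ.drop-*≡* (ℚᵘ.≃-trans (ℚᵘ.≃-sym (toℚᵘ-ι i)) (ℚᵘ.≃-trans (ℚ.toℚᵘ-cong eq) (toℚᵘ-ι j))))

  ι-* : ∀ i j → ι (i ℤ.* j) ≡ ι i ℚ.* ι j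
  ι-* i j = ℚ.toℚᵘ-injective (begin
    ℚ.toℚᵘ (ι (i ℤ.* j))             ≈⟨ toℚᵘ-ι (i ℤ.* j) ⟩
    mkℚᵘ i 0 ℚᵘ.* mkℚᵘ j 0            ≈⟨ ℚᵘ.*-cong (toℚᵘ-ι i) (toℚᵘ-ι j) ⟨
    ℚ.toℚᵘ (ι i) ℚᵘ.* ℚ.toℚᵘ (ι j)   ≈⟨ ℚ.toℚᵘ-homo-* (ι i) (ι j) ⟨
    ℚ.toℚᵘ (ι i ℚ.* ι j)             ∎)
    where open ℚᵘ.≃-Reasoning

  ι-+ : ∀ i j → ι (i ℤ.+ j) ≡ ι i ℚ.+ ι j
  ι-+ i j = ℚ.toℚᵘ-injective (begin
    ℚ.toℚᵘ (ι (i ℤ.+ j))             ≈⟨ toℚᵘ-ι (i ℤ.+ j) ⟩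
    mkℚᵘ (i ℤ.+ j) 0                 ≡⟨ cong₂ (λ a b → mkℚᵘ (a ℤ.+ b) 0) (ℤ.*-identityʳ i) (ℤ.*-identityʳ j) ⟨
    mkℚᵘ i 0 ℚᵘ.+ mkℚᵘ j 0            ≈⟨ ℚᵘ.+-cong (toℚᵘ-ι i) (toℚᵘ-ι j) ⟨
    ℚ.toℚᵘ (ι i) ℚᵘ.+ ℚ.toℚᵘ (ι j)   ≈⟨ ℚ.toℚᵘ-homo-+ (ι i) (ι j) ⟨
    ℚ.toℚᵘ (ι i ℚ.+ ι j)             ∎)
    where open ℚᵘ.≃-Reasoning

  ι≢0 : ∀ {i} → i ≢ 0ℤ → ι i ≢ 0ℚ
  ι≢0 i≢0 eq = i≢0 (ι-injective eq)

  ÷₀-*-cancel : ∀ p {q} → q ≢ 0ℚ → (p ÷₀ q) ℚ.* q ≡ p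
  ÷₀-*-cancel p {q} q≢0 with q ℚ.≟ 0ℚ
  ... | yes q≡0 = contradiction q≡0 q≢0
  ... | no  ¬q≡0 = begin
    p ℚ.* (ℚ.1/ q) ℚ.* q   ≡⟨ ℚ.*-assoc p (ℚ.1/ q) q ⟩
    p ℚ.* ((ℚ.1/ q) ℚ.* q) ≡⟨ cong (p ℚ.*_) (ℚ.*-inverseˡ q) ⟩
    p ℚ.* 1ℚ               ≡⟨ ℚ.*-identityʳ p ⟩
    p                      ∎
    where
    open ≡-Reasoning
    instance _ = ≢-nonZero ¬q≡0

  *-cancelʳ : ∀ {p q r} → r ≢ 0ℚ → p ℚ.* r ≡ q ℚ.* r → p ≡ q
  *-cancelʳ {p} {q} {r} r≢0 eq = begin
    p                      ≡⟨ expand p ⟨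
    p ℚ.* r ℚ.* (ℚ.1/ r)   ≡⟨ cong (ℚ._* (ℚ.1/ r)) eq ⟩
    q ℚ.* r ℚ.* (ℚ.1/ r)   ≡⟨ expand q ⟩
    q                      ∎
    where
    open ≡-Reasoning
    instance _ = ≢-nonZero r≢0
    expand : ∀ x → x ℚ.* r ℚ.* (ℚ.1/ r) ≡ x
    expand x = trans (ℚ.*-assoc x r (ℚ.1/ r)) (trans (cong (x ℚ.*_) (ℚ.*-inverseʳ r)) (ℚ.*-identityʳ x))

  -- The last hypothesis is the claim with denominators cleared. The nonzero conditions, including
  -- the derived `y≢0`, keep every `÷₀` away from its default value.
  one-minus-quotient : ∀ {a b a′ b′ n m} → b ≢ 0ℤ → a′ ≢ 0ℤ → b′ ≢ 0ℤ → m ≢ 0ℤ →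
    n ℤ.* (b ℤ.* a′) ℤ.+ a ℤ.* b′ ℤ.* m ≡ b ℤ.* a′ ℤ.* m →
    1ℚ ℚ.- (a // b) ÷₀ (a′ // b′) ≡ n // m
  one-minus-quotient {a} {b} {a′} {b′} {n} {m} b≢0 a′≢0 b′≢0 m≢0 eq =
    *-cancelʳ (ι≢0 m≢0) (*-cancelʳ (ι≢0 a′≢0) (*-cancelʳ (ι≢0 b≢0) scaled))
    where
    x = a // b
    y = a′ // b′
    z = x ÷₀ y
    w = n // m

    x*b : x ℚ.* ι b ≡ ι a
    x*b = ÷₀-*-cancel (ι a) (ι≢0 b≢0)

    y*b′ : y ℚ.* ι b′ ≡ ι a′
    y*b′ = ÷₀-*-cancel (ι a′) (ι≢0 b′≢0)

    y≢0 : y ≢ 0ℚ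
    y≢0 y≡0 = ι≢0 a′≢0 (trans (sym y*b′) (trans (cong (ℚ._* ι b′) y≡0) (ℚ.*-zeroˡ (ι b′))))

    z*y : z ℚ.* y ≡ x
    z*y = ÷₀-*-cancel x y≢0

    w*m : w ℚ.* ι m ≡ ι n
    w*m = ÷₀-*-cancel (ι n) (ι≢0 m≢0)

    eqℚ : ι n ℚ.* (ι b ℚ.* ι a′) ℚ.+ ι a ℚ.* ι b′ ℚ.* ι m ≡ ι b ℚ.* ι a′ ℚ.* ι m
    eqℚ = begin
      ι n ℚ.* (ι b ℚ.* ι a′) ℚ.+ ι a ℚ.* ι b′ ℚ.* ι m
        ≡⟨ cong₂ ℚ._+_ (trans (ι-* n (b ℤ.* a′)) (cong (ι n ℚ.*_) (ι-* b a′)))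
                       (trans (ι-* (a ℤ.* b′) m) (cong (ℚ._* ι m) (ι-* a b′))) ⟨
      ι (n ℤ.* (b ℤ.* a′)) ℚ.+ ι (a ℤ.* b′ ℤ.* m)
        ≡⟨ ι-+ (n ℤ.* (b ℤ.* a′)) (a ℤ.* b′ ℤ.* m) ⟨
      ι (n ℤ.* (b ℤ.* a′) ℤ.+ a ℤ.* b′ ℤ.* m)
        ≡⟨ cong ι eq ⟩
      ι (b ℤ.* a′ ℤ.* m)
        ≡⟨ trans (ι-* (b ℤ.* a′) m) (cong (ℚ._* ι m) (ι-* b a′)) ⟩
      ι b ℚ.* ι a′ ℚ.* ι m ∎
      where open ≡-Reasoning

    open ≡-Reasoning
    open +-*-Solver

    scaled : (1ℚ ℚ.- z) ℚ.* ι m ℚ.* ι a′ ℚ.* ι b ≡ w ℚ.* ι m ℚ.* ι a′ ℚ.* ι b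
    scaled = begin
      (1ℚ ℚ.- z) ℚ.* ι m ℚ.* ι a′ ℚ.* ι b
        ≡⟨ solve 4 (λ z m a′ b → (con 1ℚ :- z) :* m :* a′ :* b := b :* a′ :* m :- z :* a′ :* b :* m)
                 refl z (ι m) (ι a′) (ι b) ⟩
      ι b ℚ.* ι a′ ℚ.* ι m ℚ.- z ℚ.* ι a′ ℚ.* ι b ℚ.* ι m
        ≡⟨ cong₂ ℚ._-_ (sym eqℚ) (cong (λ r → r ℚ.* ι b ℚ.* ι m) z*a′) ⟩
      ι n ℚ.* (ι b ℚ.* ι a′) ℚ.+ ι a ℚ.* ι b′ ℚ.* ι m ℚ.- x ℚ.* ι b′ ℚ.* ι b ℚ.* ι m
        ≡⟨ cong (λ r → ι n ℚ.* (ι b ℚ.* ι a′) ℚ.+ r ℚ.* ι b′ ℚ.* ι m ℚ.- x ℚ.* ι b′ ℚ.* ι b ℚ.* ι m) x*b ⟨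
      ι n ℚ.* (ι b ℚ.* ι a′) ℚ.+ x ℚ.* ι b ℚ.* ι b′ ℚ.* ι m ℚ.- x ℚ.* ι b′ ℚ.* ι b ℚ.* ι m
        ≡⟨ solve 6 (λ n b a′ x b′ m → n :* (b :* a′) :+ x :* b :* b′ :* m :- x :* b′ :* b :* m := n :* a′ :* b)
                 refl (ι n) (ι b) (ι a′) x (ι b′) (ι m) ⟩
      ι n ℚ.* ι a′ ℚ.* ι b
        ≡⟨ cong (λ r → r ℚ.* ι a′ ℚ.* ι b) w*m ⟨
      w ℚ.* ι m ℚ.* ι a′ ℚ.* ι b ∎
      where
      z*a′ : z ℚ.* ι a′ ≡ x ℚ.* ι b′
      z*a′ = begin
        z ℚ.* ι a′           ≡⟨ cong (z ℚ.*_) y*b′ ⟨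
        z ℚ.* (y ℚ.* ι b′)   ≡⟨ ℚ.*-assoc z y (ι b′) ⟨
        z ℚ.* y ℚ.* ι b′     ≡⟨ cong (ℚ._* ι b′) z*y ⟩
        x ℚ.* ι b′           ∎

open RationalQuotients

-- Certifying the graph distance by local conditions

module Metrics where

  open import Data.Nat using (ℕ; zero; suc; _+_; _≤_; _<_; s≤s; z<s; s<s)
  open import Data.Nat.Properties
    using (≤-reflexive; ≤-trans; 0≢1+n; 1+n≰n; suc-injective; m≤n⇒m≤1+n; <⇒≱)
  open import Data.Vec as Vec using (Vec; []; _∷_)
  open import Data.Vec.Relation.Unary.All as VecAll using ([]; _∷_)
  open import Data.Vec.Relation.Unary.AllPairs using ([]; _∷_)
  open import Data.Vec.Relation.Unary.Linked using (Linked; [-]; _∷_)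
  import Data.Vec.Relation.Unary.Unique.Propositional as VecUnique
  import Data.Vec.Relation.Unary.Unique.Propositional.Properties as VecUnique

  -- Stated for a general `f` because the recursion on `applyUpTo` shifts the function; `upTo` is
  -- the case of the identity.
  find-applyUpTo-least : ∀ {P : ℕ → Set} (P? : Decidable P) f {n k} → k < n → P (f k) →
    (∀ {j} → j < k → ¬ P (f j)) → find P? (applyUpTo f n) ≡ just (f k)
  find-applyUpTo-least P? f {suc n} {zero} _ p least with P? (f 0)
  ... | yes _ = refl
  ... | no ¬p = contradiction p ¬p
  find-applyUpTo-least P? f {suc n} {suc k} (s≤s k<n) p least with P? (f 0)
  ... | yes q = contradiction q (least z<s)
  ... | no  _ = find-applyUpTo-least P? (λ i → f (suc i)) k<n p (λ j<k → least (s<s j<k))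

  -- These conditions determine δ: `step` makes every walk to z at least δ long, and `descend`
  -- produces a walk of exactly that length. In particular G is connected.
  record IsMetric (G : Graph) (δ : Graph.Node G → Graph.Node G → ℕ) : Set where
    open Graph G
    field
      δ-refl  : ∀ x → δ x x ≡ 0
      step    : ∀ {x y} z → x ~ y → δ x z ≤ suc (δ y z)
      descend : ∀ x z → x ≡ z ⊎ ∃ λ y → x ~ y × δ x z ≡ suc (δ y z)

  module _ {G : Graph} where
    open Graph G

    -- Pigeonhole on positions in `nodes`. It puts the length of a geodesic below the order, inside
    -- the range that `dist` searches.
    Unique⇒≤order : ∀ {n} {xs : Vec Node n} → VecUnique.Unique xs → n ≤ order
    Unique⇒≤order {xs = xs} uniq = Fin.injective⇒≤ {f = position} position-injective
      where
      position : Fin _ → Fin order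
      position i = index (complete (Vec.lookup xs i))
      position-injective : ∀ {i j} → position i ≡ position j → i ≡ j
      position-injective {i} {j} eq = VecUnique.lookup-injective uniq i j
        (trans (lookup-index (complete (Vec.lookup xs i)))
          (trans (cong (lookup nodes) eq) (sym (lookup-index (complete (Vec.lookup xs j))))))

    module _ {δ : Node → Node → ℕ} (isMetric : IsMetric G δ) where
      open IsMetric isMetric

      δ≤length : ∀ {k} (xs : Vec Node (suc k)) → Linked _~_ xs → δ (Vec.head xs) (Vec.last xs) ≤ k
      δ≤length (x ∷ [])     [-]     = ≤-reflexive (δ-refl x)
      δ≤length (x ∷ y ∷ xs) (e ∷ l) = ≤-trans (step _ e) (s≤s (δ≤length (y ∷ xs) l))

      -- Follow `descend` until z is reached. The bound on δ along the path is the invariant that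
      -- gives distinct nodes.
      geodesic : ∀ k {x z} → δ x z ≡ k →
        ∃ λ (xs : Vec Node (suc k)) → IsPath x z xs × VecAll.All (λ y → δ y z ≤ k) xs
      geodesic k       {x} {z} eq with descend x z
      geodesic zero    {x} eq | inj₁ refl = x ∷ [] , (refl , refl , [-] , [] ∷ []) , ≤-reflexive eq ∷ []
      geodesic zero    eq | inj₂ (_ , _ , eq′) = contradiction (trans (sym eq) eq′) 0≢1+n
      geodesic (suc k) eq | inj₁ refl = contradiction (trans (sym (δ-refl _)) eq) 0≢1+n
      geodesic (suc k) {x} eq | inj₂ (y , x~y , eq′)
        with xs@(_ ∷ _) , (refl , last≡z , linked , uniq) , near ← geodesic k (suc-injective (trans (sym eq′) eq))
        = x ∷ xs
        , (refl , last≡z , x~y ∷ linked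
          -- The new first node has δ equal to k + 1, whereas all later nodes have δ at most k.
          , VecAll.map (λ { δ≤k refl → 1+n≰n (≤-trans (≤-reflexive (sym eq)) δ≤k) }) near ∷ uniq)
        , ≤-reflexive eq ∷ VecAll.map m≤n⇒m≤1+n near

      dist≡δ : ∀ x z → dist x z ≡ δ x z
      dist≡δ x z with xs , path@(_ , _ , _ , uniq) , _ ← geodesic (δ x z) refl
        = cong (fromMaybe 0) (find-applyUpTo-least (path? x z) (λ k → k) (Unique⇒≤order uniq) (xs , path) least)
        where
        least : ∀ {j} → j < δ x z → ¬ Path x z j
        least j<δ (ys , refl , refl , linked , _) = <⇒≱ j<δ (δ≤length ys linked)

      -- The filter drops only entries equal to x, and those contribute δ x x = 0.
      sum-filter-distinct : ∀ x ys → sum (map (dist x) (filter (λ y → ¬? (x ≟ y)) ys)) ≡ sum (map (δ x) ys)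
      sum-filter-distinct x []       = refl
      sum-filter-distinct x (y ∷ ys) with x ≟ y
      ... | yes refl = trans (sum-filter-distinct x ys) (cong (_+ sum (map (δ x) ys)) (sym (δ-refl x)))
      ... | no  _    = cong₂ _+_ (dist≡δ x y) (sum-filter-distinct x ys)

      totalDist≡ : totalDist ≡ sum (map (λ x → sum (map (δ x) nodes)) nodes)
      totalDist≡ = cong sum (map-cong (λ x → sum-filter-distinct x nodes) nodes)

open Metrics

-- Invariance under isomorphism, and contractions as quotients

module Isomorphisms where

  open import Data.Nat using (ℕ; suc)

  record _≅_ (G H : Graph) : Set where
    private
      module G = Graph G
      module H = Graph H
    field
      to         : G.Node → H.Node
      injective  : ∀ {x y} → to x ≡ to y → x ≡ y
      surjective : ∀ b → ∃ λ x → to x ≡ b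
      preserves  : ∀ {x y} → x G.~ y → to x H.~ to y
      reflects   : ∀ {x y} → to x H.~ to y → x G.~ y

  module _ {G H : Graph} (G≅H : G ≅ H) where
    private
      module G = Graph G
      module H = Graph H
    open _≅_ G≅H

    -- Both lists contain every node of H exactly once, so they agree as bags.
    map-nodes-↭ : map to G.nodes ↭ H.nodes
    map-nodes-↭ = ∼bag⇒↭ (unique∧set⇒bag (Unique.map⁺ injective G.unique) H.unique
      (mk⇔ (λ _ → H.complete _) (λ _ → in-image (surjective _))))
      where
      in-image : ∀ {b} → (∃ λ x → to x ≡ b) → b ∈ map to G.nodes
      in-image (x , refl) = ∈-map⁺ to (G.complete x)

    order-≅ : G.order ≡ H.order
    order-≅ = trans (sym (length-map to G.nodes)) (↭-length map-nodes-↭)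

    module _ {δ : H.Node → H.Node → ℕ} (isMetric : IsMetric H δ) where
      open IsMetric isMetric

      pullback : IsMetric G (δ on to)
      pullback = record
        { δ-refl  = λ x → δ-refl (to x)
        ; step    = λ z x~y → step (to z) (preserves x~y)
        ; descend = λ x z → descendᴳ x z (descend (to x) (to z))
        }
        where
        descendᴳ : ∀ x z → to x ≡ to z ⊎ (∃ λ b → to x H.~ b × δ (to x) (to z) ≡ suc (δ b (to z))) →
          x ≡ z ⊎ ∃ λ y → x G.~ y × δ (to x) (to z) ≡ suc (δ (to y) (to z))
        descendᴳ x z (inj₁ eq) = inj₁ (injective eq)
        descendᴳ x z (inj₂ (b , x~b , eq)) with y , refl ← surjective b = inj₂ (y , reflects x~b , eq)

      totalDist-≅ : G.totalDist ≡ H.totalDist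
      totalDist-≅ = begin
        G.totalDist
          ≡⟨ totalDist≡ pullback ⟩
        sum (map (λ x → sum (map (λ y → δ (to x) (to y)) G.nodes)) G.nodes)
          ≡⟨ cong sum (map-cong (λ x → cong sum (map-∘ G.nodes)) G.nodes) ⟩
        sum (map (λ x → sum (map (δ (to x)) (map to G.nodes))) G.nodes)
          ≡⟨ cong sum (map-cong (λ x → sum-↭ (map⁺ (δ (to x)) map-nodes-↭)) G.nodes) ⟩
        sum (map (λ x → sum (map (δ (to x)) H.nodes)) G.nodes)
          ≡⟨ cong sum (map-∘ G.nodes) ⟩
        sum (map (λ a → sum (map (δ a) H.nodes)) (map to G.nodes))
          ≡⟨ sum-↭ (map⁺ _ map-nodes-↭) ⟩
        sum (map (λ a → sum (map (δ a) H.nodes)) H.nodes)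
          ≡⟨ totalDist≡ isMetric ⟨
        H.totalDist ∎
        where open ≡-Reasoning

  -- H is the quotient of G by the closed neighbourhood of w, phrased through a map on the nodes of
  -- G so that `CNode` does not appear. An edge may be crushed to a point (`hom`), and every edge of
  -- H must come from one of G (`lift`).
  record IsContraction (G H : Graph) (w : Graph.Node G) (π : Graph.Node G → Graph.Node H) : Set where
    private
      module G = Graph G
      module H = Graph H
    open Contraction G w using (Replaced)
    field
      collapse   : ∀ {x} → Replaced x → π x ≡ π w
      fibre      : ∀ {x y} → π x ≡ π y → x ≡ y ⊎ Replaced x × Replaced y
      surjective : ∀ b → ∃ λ x → π x ≡ b
      hom        : ∀ {x y} → x G.~ y → π x H.~ π y ⊎ π x ≡ π y
      lift       : ∀ {a b} → a H.~ b → ∃₂ λ x y → π x ≡ a × π y ≡ b × x G.~ y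

  contract-≅ : ∀ {G H w π} → IsContraction G H w π → contract G w ≅ H
  contract-≅ {G} {H} {w} {π} isContraction = record
    { to         = to
    ; injective  = λ {x} {y} → injective {x} {y}
    ; surjective = surjectiveᶜ
    ; preserves  = λ {x} {y} → preserves {x} {y}
    ; reflects   = λ {x} {y} → reflects {x} {y}
    }
    where
    module G = Graph G
    module H = Graph H
    open Contraction G w
    open IsContraction isContraction

    to : CNode → H.Node
    to new        = π w
    to (kept x _) = π x

    w-replaced : Replaced w
    w-replaced = inj₁ refl

    fibre-kept : ∀ {x y} → ¬ Replaced y → π x ≡ π y → x ≡ y
    fibre-kept ¬r eq with fibre eq
    ... | inj₁ x≡y     = x≡y
    ... | inj₂ (_ , r) = contradiction r ¬r

    -- `kept` stores its proof irrelevantly; since the proof is only ever used to reach absurdity,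
    -- an ordinary negation can be recovered.
    kept-¬replaced : ∀ {x} → .(¬ Replaced x) → ¬ Replaced x
    kept-¬replaced ¬r r = ⊥-elim-irr (¬r r)

    replaced-if : ∀ {x} → π x ≡ π w → Replaced x
    replaced-if eq with fibre eq
    ... | inj₁ refl    = w-replaced
    ... | inj₂ (r , _) = r

    hom-kept : ∀ {x y} → ¬ Replaced y → x G.~ y → π x H.~ π y
    hom-kept ¬r x~y with hom x~y
    ... | inj₁ e  = e
    ... | inj₂ eq = contradiction x~y (G.~-irrefl (fibre-kept ¬r eq))

    injective : ∀ {a b} → to a ≡ to b → a ≡ b
    injective {new}       {new}       _  = refl
    injective {new}       {kept y ¬r} eq = contradiction (replaced-if (sym eq)) (kept-¬replaced ¬r)
    injective {kept x ¬r} {new}       eq = contradiction (replaced-if eq) (kept-¬replaced ¬r)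
    injective {kept x _}  {kept y ¬r} eq = kept-cong (fibre-kept (kept-¬replaced ¬r) eq)

    surjectiveᶜ : ∀ b → ∃ λ a → to a ≡ b
    surjectiveᶜ b with x , refl ← surjective b with replaced? x
    ... | yes r = new , sym (collapse r)
    ... | no ¬r = kept x ¬r , refl

    touches⇒~ : ∀ {y} → ¬ Replaced y → Touches y → π w H.~ π y
    touches⇒~ {y} ¬r (x , r , x~y) = subst (H._~ π y) (collapse r) (hom-kept ¬r x~y)

    -- Lift the edge: its first end lies over π w and so is replaced, while its second end is y
    -- itself, because the fibre of an unreplaced node is a singleton.
    ~⇒touches : ∀ {y} → ¬ Replaced y → π w H.~ π y → Touches y
    ~⇒touches ¬r e with x , y′ , πx≡ , πy≡ , x~y ← lift e
      = x , replaced-if πx≡ , subst (x G.~_) (fibre-kept ¬r πy≡) x~y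

    preserves : ∀ {a b} → CAdj a b → to a H.~ to b
    preserves {new}       {kept y ¬r} t = touches⇒~ (kept-¬replaced ¬r) t
    preserves {kept x ¬r} {new}       t = H.~-sym (touches⇒~ (kept-¬replaced ¬r) t)
    preserves {kept x _}  {kept y ¬r} e = hom-kept (kept-¬replaced ¬r) e

    reflects : ∀ {a b} → to a H.~ to b → CAdj a b
    reflects {new}       {new}       e = contradiction e (H.~-irrefl refl)
    reflects {new}       {kept y ¬r} e = ~⇒touches (kept-¬replaced ¬r) e
    reflects {kept x ¬r} {new}       e = ~⇒touches (kept-¬replaced ¬r) (H.~-sym e)
    reflects {kept x ¬r} {kept y ¬q} e with x′ , y′ , πx≡ , πy≡ , x~y ← lift e
      = subst₂ G._~_ (fibre-kept (kept-¬replaced ¬r) πx≡) (fibre-kept (kept-¬replaced ¬q) πy≡) x~y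

open Isomorphisms

-- The distance in a comet

module CometMetric where

  open import Data.Nat using (ℕ; zero; suc; _≤_; _<_; z≤n; s≤s; _<?_; ∣_-_∣)
  open import Data.Nat.Properties

  -- Twice the discrete metric, written by recursion so that its row sums follow by induction.
  leafDist : ∀ {s} → Fin s → Fin s → ℕ
  leafDist zero    zero    = 0
  leafDist zero    (suc _) = 2
  leafDist (suc _) zero    = 2
  leafDist (suc i) (suc j) = leafDist i j

  leafDist-refl : ∀ {s} (i : Fin s) → leafDist i i ≡ 0
  leafDist-refl zero    = refl
  leafDist-refl (suc i) = leafDist-refl i

  leafDist≤2 : ∀ {s} (i j : Fin s) → leafDist i j ≤ 2
  leafDist≤2 zero    zero    = z≤n
  leafDist≤2 zero    (suc _) = ≤-refl
  leafDist≤2 (suc _) zero    = ≤-refl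
  leafDist≤2 (suc i) (suc j) = leafDist≤2 i j

  ≡⊎leafDist≡2 : ∀ {s} (i j : Fin s) → i ≡ j ⊎ leafDist i j ≡ 2
  ≡⊎leafDist≡2 zero    zero    = inj₁ refl
  ≡⊎leafDist≡2 zero    (suc _) = inj₂ refl
  ≡⊎leafDist≡2 (suc _) zero    = inj₂ refl
  ≡⊎leafDist≡2 (suc i) (suc j) with ≡⊎leafDist≡2 i j
  ... | inj₁ i≡j = inj₁ (cong suc i≡j)
  ... | inj₂ eq  = inj₂ eq

  ∣n-1+n∣≡1 : ∀ n → ∣ n - suc n ∣ ≡ 1
  ∣n-1+n∣≡1 zero    = refl
  ∣n-1+n∣≡1 (suc n) = ∣n-1+n∣≡1 n

  ∣1+n-n∣≡1 : ∀ n → ∣ suc n - n ∣ ≡ 1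
  ∣1+n-n∣≡1 zero    = refl
  ∣1+n-n∣≡1 (suc n) = ∣1+n-n∣≡1 n

  m<n⇒∣m-n∣≡1+∣1+m-n∣ : ∀ {m n} → m < n → ∣ m - n ∣ ≡ suc ∣ suc m - n ∣
  m<n⇒∣m-n∣≡1+∣1+m-n∣ {zero}  {suc n} _         = refl
  m<n⇒∣m-n∣≡1+∣1+m-n∣ {suc m} {suc n} (s≤s m<n) = m<n⇒∣m-n∣≡1+∣1+m-n∣ m<n

  n≤m⇒∣1+m-n∣≡1+∣m-n∣ : ∀ {m n} → n ≤ m → ∣ suc m - n ∣ ≡ suc ∣ m - n ∣
  n≤m⇒∣1+m-n∣≡1+∣m-n∣ {m} z≤n = cong suc (sym (∣-∣-identityʳ m))
  n≤m⇒∣1+m-n∣≡1+∣m-n∣ (s≤s n≤m) = n≤m⇒∣1+m-n∣≡1+∣m-n∣ n≤m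

  -- Heights are 0-based, from the free end of the path; t = 1 + n.
  module Height {s n : ℕ} where
    open Comet s (suc n)
    open Graph (comet s (suc n)) using (Node; nodes; _~_)

    height : Node → ℕ
    height (v i) = toℕ i
    height c     = n
    height (u _) = suc n

    height-edge : ∀ {x y} → Edge x y → height y ≡ suc (height x)
    height-edge (v-v eq) = suc-injective eq
    height-edge (v-c eq) = sym eq
    height-edge c-u      = refl

    edge : ∀ {x y} → height y ≡ suc (height x) → Edge x y
    edge {v i} {v j} eq = v-v (cong suc eq)
    edge {v i} {c}   eq = v-c (sym eq)
    edge {v i} {u j} eq = contradiction (suc-injective eq) (≢-sym (<⇒≢ (Fin.toℕ<n i)))
    edge {c}   {v j} eq = contradiction eq (<⇒≢ (m<n⇒m<1+n (Fin.toℕ<n j)))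
    edge {c}   {c}   eq = contradiction eq (<⇒≢ ≤-refl)
    edge {c}   {u j} eq = c-u
    edge {u i} {v j} eq = contradiction eq (<⇒≢ (m<n⇒m<1+n (m<n⇒m<1+n (Fin.toℕ<n j))))
    edge {u i} {c}   eq = contradiction eq (<⇒≢ (n≤1+n (suc n)))
    edge {u i} {u j} eq = contradiction eq (<⇒≢ ≤-refl)

    height≤1+n : ∀ x → height x ≤ suc n
    height≤1+n (v i) = <⇒≤ (m<n⇒m<1+n (Fin.toℕ<n i))
    height≤1+n c     = n≤1+n n
    height≤1+n (u _) = ≤-refl

    -- Only leaves share a height, so it is enough that one of the two nodes is not a leaf.
    height-injective : ∀ {x y} → height x ≤ n → height x ≡ height y → x ≡ y
    height-injective {v i} {v j} _   eq = cong v (Fin.toℕ-injective eq)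
    height-injective {v i} {c}   _   eq = contradiction eq (<⇒≢ (Fin.toℕ<n i))
    height-injective {v i} {u j} _   eq = contradiction eq (<⇒≢ (m<n⇒m<1+n (Fin.toℕ<n i)))
    height-injective {c}   {v j} _   eq = contradiction (sym eq) (<⇒≢ (Fin.toℕ<n j))
    height-injective {c}   {c}   _   eq = refl
    height-injective {c}   {u j} _   eq = contradiction eq (<⇒≢ ≤-refl)
    height-injective {u i}       n<n eq = contradiction n<n 1+n≰n

    spine : ℕ → Node
    spine k with k <? n
    ... | yes k<n = v (fromℕ< k<n)
    ... | no  _   = c

    height-spine : ∀ {k} → k ≤ n → height (spine k) ≡ k
    height-spine {k} k≤n with k <? n
    ... | yes k<n = Fin.toℕ-fromℕ< k<n
    ... | no  k≮n = sym (≤-antisym k≤n (≮⇒≥ k≮n))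

    δ : Node → Node → ℕ
    δ (u i) (u j) = leafDist i j
    δ (u _) (v j) = ∣ suc n - toℕ j ∣
    δ (u _) c     = ∣ suc n - n ∣
    δ (v i) z     = ∣ toℕ i - height z ∣
    δ c     z     = ∣ n - height z ∣

    δ-spineˡ : ∀ x z → height x ≤ n → δ x z ≡ ∣ height x - height z ∣
    δ-spineˡ (v i) z _ = refl
    δ-spineˡ c     z _ = refl
    δ-spineˡ (u i) z n<n = contradiction n<n 1+n≰n

    δ-spineʳ : ∀ x z → height z ≤ n → δ x z ≡ ∣ height x - height z ∣
    δ-spineʳ (v i) _ _ = refl
    δ-spineʳ c     _ _ = refl
    δ-spineʳ (u i) (v j) _ = refl
    δ-spineʳ (u i) c     _ = refl
    δ-spineʳ (u i) (u j) n<n = contradiction n<n 1+n≰n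

    height-step : ∀ {x y} → x ~ y → ∀ k → ∣ height x - k ∣ ≤ suc ∣ height y - k ∣
    height-step {x} {y} x~y k = ≤-trans (∣-∣-triangle (height x) (height y) k)
      (+-monoˡ-≤ _ (≤-reflexive (unit x~y)))
      where
      unit : ∀ {x y} → x ~ y → ∣ height x - height y ∣ ≡ 1
      unit {x} {y} (fwd e) = trans (cong (∣ height x -_∣) (height-edge e)) (∣n-1+n∣≡1 (height x))
      unit {x} {y} (bwd e) = trans (cong (∣_- height y ∣) (height-edge e)) (∣1+n-n∣≡1 (height y))

    δ-step : ∀ {x y} z → x ~ y → δ x z ≤ suc (δ y z)
    δ-step {x} {y} (v i) e = subst₂ (λ a b → a ≤ suc b)
      (sym (δ-spineʳ x (v i) (<⇒≤ (Fin.toℕ<n i)))) (sym (δ-spineʳ y (v i) (<⇒≤ (Fin.toℕ<n i)))) (height-step e (toℕ i))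
    δ-step {x} {y} c e = subst₂ (λ a b → a ≤ suc b)
      (sym (δ-spineʳ x c ≤-refl)) (sym (δ-spineʳ y c ≤-refl)) (height-step e n)
    δ-step (u k) (fwd e@(v-v _)) = height-step (fwd e) (suc n)
    δ-step (u k) (fwd e@(v-c _)) = height-step (fwd e) (suc n)
    -- For an edge at a leaf and a target leaf, δ is not a difference of heights. Towards the leaf
    -- the bound reads 1 ≤ 1 + δ; from the leaf, through c, it reads `leafDist` ≤ 2.
    δ-step (u k) (fwd c-u)       = subst (_≤ _) (sym (∣n-1+n∣≡1 n)) (s≤s z≤n)
    δ-step (u k) (bwd e@(v-v _)) = height-step (bwd e) (suc n)
    δ-step (u k) (bwd e@(v-c _)) = height-step (bwd e) (suc n)
    δ-step (u k) (bwd (c-u {j})) = subst (λ a → _ ≤ suc a) (sym (∣n-1+n∣≡1 n)) (leafDist≤2 j k)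

    Descent : Node → Node → Set
    Descent x z = ∃ λ y → x ~ y × δ x z ≡ suc (δ y z)

    ascending : ∀ x z → height x < height z → Descent x z
    ascending x z x<z with m≤n⇒m<n∨m≡n (≤-pred (≤-trans x<z (height≤1+n z)))
    ... | inj₁ x<n = spine (suc (height x)) , fwd (edge eq) , (begin
        δ x z                              ≡⟨ δ-spineˡ x z (<⇒≤ x<n) ⟩
        ∣ height x - height z ∣            ≡⟨ m<n⇒∣m-n∣≡1+∣1+m-n∣ x<z ⟩
        suc ∣ suc (height x) - height z ∣  ≡⟨ cong (λ k → suc ∣ k - height z ∣) eq ⟨
        suc ∣ height y - height z ∣        ≡⟨ cong suc (δ-spineˡ y z (≤-trans (≤-reflexive eq) x<n)) ⟨
        suc (δ y z)                        ∎)
      where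
      open ≡-Reasoning
      y = spine (suc (height x))
      eq = height-spine x<n
    ascending (u _) z     x<z | inj₂ eq = contradiction (≤-reflexive eq) 1+n≰n
    ascending (v i) z     x<z | inj₂ eq = contradiction eq (<⇒≢ (Fin.toℕ<n i))
    ascending c     (v j) x<z | inj₂ eq = contradiction (≤-trans x<z (<⇒≤ (Fin.toℕ<n j))) 1+n≰n
    ascending c     c     x<z | inj₂ eq = contradiction x<z 1+n≰n
    -- Height n leaves only x = c, so z is a leaf. The step goes to z itself, since `spine` contains
    -- no leaf and other leaves are no closer.
    ascending c     (u k) x<z | inj₂ eq =
      u k , fwd c-u , trans (∣n-1+n∣≡1 n) (cong suc (sym (leafDist-refl k)))

    descending : ∀ x z {k} → height x ≡ suc k → height z ≤ k → Descent x z
    descending x z {k} x≡ z≤k = y , bwd (edge (trans x≡ (cong suc (sym eq)))) , (begin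
        -- Here x may be a leaf, but z lies strictly below it and cannot be one, hence the rule for
        -- the right argument.
        δ x z                    ≡⟨ δ-spineʳ x z (≤-trans z≤k k≤n) ⟩
        ∣ height x - height z ∣  ≡⟨ cong (∣_- height z ∣) x≡ ⟩
        ∣ suc k - height z ∣     ≡⟨ n≤m⇒∣1+m-n∣≡1+∣m-n∣ z≤k ⟩
        suc ∣ k - height z ∣     ≡⟨ cong (λ k → suc ∣ k - height z ∣) eq ⟨
        suc ∣ height y - height z ∣  ≡⟨ cong suc (δ-spineʳ y z (≤-trans z≤k k≤n)) ⟨
        suc (δ y z)              ∎)
      where
      open ≡-Reasoning
      k≤n = ≤-pred (≤-trans (≤-reflexive (sym x≡)) (height≤1+n x))
      y = spine k
      eq = height-spine k≤n

    level : ∀ x z → height x ≡ height z → x ≡ z ⊎ Descent x z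
    level (u i) (u j) _ with ≡⊎leafDist≡2 i j
    ... | inj₁ i≡j = inj₁ (cong u i≡j)
    ... | inj₂ eq  = inj₂ (c , bwd c-u , trans eq (cong suc (sym (∣n-1+n∣≡1 n))))
    level (v i) z eq = inj₁ (height-injective (<⇒≤ (Fin.toℕ<n i)) eq)
    level c     z eq = inj₁ (height-injective ≤-refl eq)
    level (u i) (v j) eq = contradiction (sym eq) (<⇒≢ (m<n⇒m<1+n (Fin.toℕ<n j)))
    level (u i) c     eq = contradiction (sym eq) (<⇒≢ ≤-refl)

    δ-descend : ∀ x z → x ≡ z ⊎ Descent x z
    δ-descend x z with <-cmp (height x) (height z)
    ... | tri< x<z _ _ = inj₂ (ascending x z x<z)
    ... | tri≈ _ eq _  = level x z eq
    ... | tri> _ _ z<x with height x in eq | z<x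
    ...   | suc k | s≤s z≤k = inj₂ (descending x z eq z≤k)

    δ-isMetric : IsMetric (comet s (suc n)) δ
    δ-isMetric = record { δ-refl = δ-refl ; step = δ-step ; descend = δ-descend }
      where
      δ-refl : ∀ x → δ x x ≡ 0
      δ-refl (v i) = ∣n-n∣≡0 (toℕ i)
      δ-refl c     = ∣n-n∣≡0 n
      δ-refl (u j) = leafDist-refl j

open CometMetric

-- The total distance of a comet

module CometTotals where

  open import Data.Integer using (ℤ; +_)
  open import Data.Nat using (ℕ; zero; suc; pred; _+_; _*_; _≤_; ∣_-_∣)
  open import Data.Nat.Properties

  open ≡-Reasoning

  Σ< : ℕ → (ℕ → ℕ) → ℕ
  Σ< n f = sum (applyUpTo f n)

  Σ<-suc : ∀ n f → Σ< (suc n) f ≡ Σ< n f + f n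
  Σ<-suc n f = begin
    sum (applyUpTo f (suc n))      ≡⟨ cong sum (applyUpTo-∷ʳ f n) ⟨
    sum (applyUpTo f n ∷ʳ f n)     ≡⟨ sum-++ (applyUpTo f n) (f n ∷ []) ⟩
    Σ< n f + (f n + 0)             ≡⟨ cong (_+_ (Σ< n f)) (+-identityʳ (f n)) ⟩
    Σ< n f + f n                   ∎

  Σ<-+ : ∀ n f g → Σ< n (λ k → f k + g k) ≡ Σ< n f + Σ< n g
  Σ<-+ zero    f g = refl
  Σ<-+ (suc n) f g = trans (cong (_+_ (f 0 + g 0)) (Σ<-+ n (f ∘ suc) (g ∘ suc))) (lemma (f 0) (g 0) _ _)
    where
    lemma : ∀ a b x y → a + b + (x + y) ≡ a + x + (b + y)
    lemma = solve-∀

  Σ<-* : ∀ n m f → Σ< n (λ k → m * f k) ≡ m * Σ< n f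
  Σ<-* zero    m f = sym (*-zeroʳ m)
  Σ<-* (suc n) m f = trans (cong (_+_ (m * f 0)) (Σ<-* n m (f ∘ suc))) (sym (*-distribˡ-+ m (f 0) _))

  Σ<-cong : ∀ n {f g : ℕ → ℕ} → (∀ k → f k ≡ g k) → Σ< n f ≡ Σ< n g
  Σ<-cong zero    eq = refl
  Σ<-cong (suc n) eq = cong₂ _+_ (eq 0) (Σ<-cong n (eq ∘ suc))

  tabulate-toℕ : ∀ n (f : ℕ → ℕ) → tabulate {n = n} (f ∘ toℕ) ≡ applyUpTo f n
  tabulate-toℕ zero    f = refl
  tabulate-toℕ (suc n) f = cong (f 0 ∷_) (tabulate-toℕ n (f ∘ suc))

  sum-tabulate-const : ∀ s m → sum (tabulate {n = s} (λ _ → m)) ≡ s * m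
  sum-tabulate-const zero    m = refl
  sum-tabulate-const (suc s) m = cong (_+_ m) (sum-tabulate-const s m)

  sum-leafDist : ∀ {s} (i : Fin s) → sum (tabulate (leafDist i)) ≡ 2 * pred s
  sum-leafDist {suc s} zero = trans (sum-tabulate-const s 2) (*-comm s 2)
  sum-leafDist {suc (suc s)} (suc i) = trans (cong (_+_ 2) (sum-leafDist i)) (sym (*-suc 2 s))

  Σ∣n-k∣ : ∀ n → 2 * Σ< n (λ k → ∣ n - k ∣) ≡ n * suc n
  Σ∣n-k∣ zero    = refl
  Σ∣n-k∣ (suc n) = begin
    2 * (suc n + Σ< n (λ k → ∣ n - k ∣))      ≡⟨ *-distribˡ-+ 2 (suc n) _ ⟩
    2 * suc n + 2 * Σ< n (λ k → ∣ n - k ∣)    ≡⟨ cong (_+_ (2 * suc n)) (Σ∣n-k∣ n) ⟩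
    2 * suc n + n * suc n                     ≡⟨ lemma n ⟩
    suc n * suc (suc n)                       ∎
    where
    lemma : ∀ n → 2 * suc n + n * suc n ≡ suc n * suc (suc n)
    lemma = solve-∀

  pathTotal : ℕ → ℕ
  pathTotal n = Σ< n (λ k → Σ< n (λ l → ∣ k - l ∣))

  -- A new end-node adds a row and a column with equal sums, meeting in a zero.
  pathTotal-suc : ∀ n → pathTotal (suc n) ≡ pathTotal n + 2 * Σ< n (λ k → ∣ n - k ∣)
  pathTotal-suc n = begin
    Σ< (suc n) row
      ≡⟨ Σ<-suc n row ⟩
    Σ< n row + row n
      ≡⟨ cong₂ _+_ (trans (Σ<-cong n (λ k → trans (Σ<-suc n (λ l → ∣ k - l ∣))
                                         (cong (_+_ (Σ< n (λ l → ∣ k - l ∣))) (∣-∣-comm k n))))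
                          (Σ<-+ n (λ k → Σ< n (λ l → ∣ k - l ∣)) (λ k → ∣ n - k ∣)))
                   (trans (Σ<-suc n (λ l → ∣ n - l ∣)) (cong (_+_ B) (∣n-n∣≡0 n))) ⟩
    pathTotal n + B + (B + 0)
      ≡⟨ +-assoc (pathTotal n) B (B + 0) ⟩
    pathTotal n + 2 * B ∎
    where
    row : ℕ → ℕ
    row k = Σ< (suc n) (λ l → ∣ k - l ∣)
    B = Σ< n (λ k → ∣ n - k ∣)

  -- Ordered pairs count the Wiener index of a path twice; for m nodes this index is the binomial
  -- coefficient of m + 1 over 3.
  pathTotal-closed : ∀ n → 3 * pathTotal (suc n) ≡ n * (suc n * suc (suc n))
  pathTotal-closed zero    = refl
  pathTotal-closed (suc n) = begin
    3 * pathTotal (suc (suc n))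
      ≡⟨ cong (3 *_) (trans (pathTotal-suc (suc n)) (cong (_+_ (pathTotal (suc n))) (Σ∣n-k∣ (suc n)))) ⟩
    3 * (pathTotal (suc n) + suc n * suc (suc n))
      ≡⟨ *-distribˡ-+ 3 (pathTotal (suc n)) _ ⟩
    3 * pathTotal (suc n) + 3 * (suc n * suc (suc n))
      ≡⟨ cong (_+ 3 * (suc n * suc (suc n))) (pathTotal-closed n) ⟩
    n * (suc n * suc (suc n)) + 3 * (suc n * suc (suc n))
      ≡⟨ lemma n ⟩
    suc n * (suc (suc n) * suc (suc (suc n))) ∎
    where
    lemma : ∀ n → n * (suc n * suc (suc n)) + 3 * (suc n * suc (suc n)) ≡
      suc n * (suc (suc n) * suc (suc (suc n)))
    lemma = solve-∀

  module _ (s n : ℕ) where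
    open Comet s (suc n)
    open Graph (comet s (suc n)) using (Node; nodes; order; totalDist)
    open Height {s} {n}

    order-comet : order ≡ suc n + s
    order-comet = begin
      length (vs ++ c ∷ us)                    ≡⟨ length-++ vs ⟩
      length vs + suc (length us)              ≡⟨ cong₂ (λ a b → a + suc b)
                                                    (trans (length-map (v {s} {suc n}) (allFin n)) (length-tabulate {n = n} (λ i → i)))
                                                    (trans (length-map (u {s} {suc n}) (allFin s)) (length-tabulate {n = s} (λ i → i))) ⟩
      n + suc s                                ≡⟨ +-suc n s ⟩
      suc n + s                                ∎

    -- The leaves are summed separately because a distance between two leaves is not a function of
    -- their heights.
    sum-nodes : ∀ (f : Node → ℕ) (γ : ℕ → ℕ) → (∀ x → height x ≤ n → f x ≡ γ (height x)) →
      sum (map f nodes) ≡ Σ< (suc n) γ + sum (tabulate (f ∘ u))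
    sum-nodes f γ spine≡ = begin
      sum (map f (vs ++ c ∷ us))
        ≡⟨ cong sum (map-++ f vs (c ∷ us)) ⟩
      sum (map f vs ++ f c ∷ map f us)
        ≡⟨ sum-++ (map f vs) (f c ∷ map f us) ⟩
      sum (map f vs) + (f c + sum (map f us))
        ≡⟨ +-assoc (sum (map f vs)) (f c) (sum (map f us)) ⟨
      sum (map f vs) + f c + sum (map f us)
        ≡⟨ cong₂ _+_ (cong₂ (λ xs y → sum xs + y) vs≡ (spine≡ c ≤-refl)) (cong sum (map-allFin u)) ⟩
      Σ< n γ + γ n + sum (tabulate (f ∘ u))
        ≡⟨ cong (_+ sum (tabulate (f ∘ u))) (Σ<-suc n γ) ⟨
      Σ< (suc n) γ + sum (tabulate (f ∘ u)) ∎
      where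
      map-allFin : ∀ {m} (g : Fin m → Node) → map f (map g (allFin m)) ≡ tabulate (f ∘ g)
      map-allFin g = trans (cong (map f) (map-tabulate (λ i → i) g)) (map-tabulate g f)
      vs≡ : map f vs ≡ applyUpTo γ n
      vs≡ = trans (map-allFin v)
        (trans (tabulate-cong (λ i → spine≡ (v i) (<⇒≤ (Fin.toℕ<n i)))) (tabulate-toℕ n γ))

    -- The blocks of the distance matrix: path to path, path to leaf in both orders, and leaf to
    -- leaf, where each leaf has s - 1 others at distance 2.
    totalDist-sum : totalDist ≡
      pathTotal (suc n) + s * (2 * Σ< (suc n) (λ k → ∣ suc n - k ∣) + 2 * pred s)
    totalDist-sum = begin
      totalDist
        ≡⟨ totalDist≡ δ-isMetric ⟩
      sum (map (λ x → sum (map (δ x) nodes)) nodes)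
        ≡⟨ sum-nodes _ (λ k → Σ< (suc n) (λ l → ∣ k - l ∣) + s * ∣ suc n - k ∣) spine-row ⟩
      Σ< (suc n) (λ k → Σ< (suc n) (λ l → ∣ k - l ∣) + s * ∣ suc n - k ∣)
        + sum (tabulate (λ i → sum (map (δ (u i)) nodes)))
        ≡⟨ cong₂ _+_ (trans (Σ<-+ (suc n) (λ k → Σ< (suc n) (λ l → ∣ k - l ∣)) (λ k → s * ∣ suc n - k ∣))
                            (cong (_+_ (pathTotal (suc n))) (Σ<-* (suc n) s (λ k → ∣ suc n - k ∣))))
                     (trans (cong sum (tabulate-cong leaf-row)) (sum-tabulate-const s _)) ⟩
      pathTotal (suc n) + s * B + s * (B + 2 * pred s)
        ≡⟨ lemma (pathTotal (suc n)) s B (2 * pred s) ⟩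
      pathTotal (suc n) + s * (2 * B + 2 * pred s) ∎
      where
      B = Σ< (suc n) (λ k → ∣ suc n - k ∣)
      lemma : ∀ a s b p → a + s * b + s * (b + p) ≡ a + s * (2 * b + p)
      lemma = solve-∀

      spine-row : ∀ x → height x ≤ n → sum (map (δ x) nodes) ≡
        Σ< (suc n) (λ l → ∣ height x - l ∣) + s * ∣ suc n - height x ∣
      spine-row x x≤n = trans
        (sum-nodes (δ x) (λ l → ∣ height x - l ∣) (λ z _ → δ-spineˡ x z x≤n))
        (cong (_+_ (Σ< (suc n) (λ l → ∣ height x - l ∣))) (trans
          (cong sum (tabulate-cong (λ j → trans (δ-spineˡ x (u j) x≤n) (∣-∣-comm (height x) (suc n)))))
          (sum-tabulate-const s _)))

      leaf-row : ∀ i → sum (map (δ (u i)) nodes) ≡ B + 2 * pred s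
      leaf-row i = trans
        (sum-nodes (δ (u i)) (λ l → ∣ suc n - l ∣) (λ z z≤n → δ-spineʳ (u i) z z≤n))
        (cong (_+_ B) (sum-leafDist i))

    totalDist-comet : 3 * totalDist ≡
      n * (suc n * suc (suc n)) + 3 * (s * (suc n * suc (suc n) + 2 * pred s))
    totalDist-comet = begin
      3 * totalDist
        ≡⟨ cong (3 *_) totalDist-sum ⟩
      3 * (pathTotal (suc n) + s * (2 * Σ< (suc n) (λ k → ∣ suc n - k ∣) + 2 * pred s))
        ≡⟨ *-distribˡ-+ 3 (pathTotal (suc n)) _ ⟩
      3 * pathTotal (suc n) + 3 * (s * (2 * Σ< (suc n) (λ k → ∣ suc n - k ∣) + 2 * pred s))
        ≡⟨ cong₂ (λ a b → a + 3 * (s * (b + 2 * pred s))) (pathTotal-closed n) (Σ∣n-k∣ (suc n)) ⟩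
      n * (suc n * suc (suc n)) + 3 * (s * (suc n * suc (suc n) + 2 * pred s)) ∎

  D : ℤ → ℤ → ℤ
  D S T = T ℤ.* (T ℤ.+ + 1) ℤ.* (T ℤ.+ + 3 ℤ.* S ℤ.- + 1) ℤ.+ + 6 ℤ.* S ℤ.* (S ℤ.- + 1)

  -- At s = 0 the truncated `pred s` differs from s - 1, but the factor s hides this. The case
  -- occurs: contracting c leaves no leaves.
  +-s*pred[s] : ∀ s → + (s * pred s) ≡ + s ℤ.* (+ s ℤ.- + 1)
  +-s*pred[s] zero    = refl
  +-s*pred[s] (suc s) = ℤ.pos-* (suc s) s

  module _ (s n : ℕ) where
    open Graph (comet s (suc n)) using (totalDist)

    3*totalDist≡D : + 3 ℤ.* + totalDist ≡ D (+ s) (+ suc n)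
    3*totalDist≡D = begin
      + 3 ℤ.* + totalDist
        ≡⟨ ℤ.pos-* 3 totalDist ⟨
      + (3 * totalDist)
        ≡⟨ cong +_ (trans (totalDist-comet s n) (regroup n s (pred s))) ⟩
      + (n * (suc n * suc (suc n)) + 3 * (s * (suc n * suc (suc n))) + 6 * (s * pred s))
        ≡⟨ cong₂ ℤ._+_ (cong₂ ℤ._+_
             (trans (ℤ.pos-* n (suc n * suc (suc n))) (cong (+ n ℤ.*_) (ℤ.pos-* (suc n) (suc (suc n)))))
             (trans (ℤ.pos-* 3 (s * (suc n * suc (suc n)))) (cong (+ 3 ℤ.*_) (trans (ℤ.pos-* s (suc n * suc (suc n)))
               (cong (+ s ℤ.*_) (ℤ.pos-* (suc n) (suc (suc n))))))))
             (trans (ℤ.pos-* 6 (s * pred s)) (cong (+ 6 ℤ.*_) (+-s*pred[s] s))) ⟩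
      + n ℤ.* (+ suc n ℤ.* + suc (suc n)) ℤ.+ + 3 ℤ.* (+ s ℤ.* (+ suc n ℤ.* + suc (suc n)))
        ℤ.+ + 6 ℤ.* (+ s ℤ.* (+ s ℤ.- + 1))
        ≡⟨ polynomial (+ s) (+ n) ⟩
      D (+ s) (+ suc n) ∎
      where
      regroup : ∀ n s p → n * (suc n * suc (suc n)) + 3 * (s * (suc n * suc (suc n) + 2 * p)) ≡
        n * (suc n * suc (suc n)) + 3 * (s * (suc n * suc (suc n))) + 6 * (s * p)
      regroup = solve-∀
      polynomial : ∀ S N → N ℤ.* ((+ 1 ℤ.+ N) ℤ.* (+ 2 ℤ.+ N)) ℤ.+ + 3 ℤ.* (S ℤ.* ((+ 1 ℤ.+ N) ℤ.* (+ 2 ℤ.+ N)))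
        ℤ.+ + 6 ℤ.* (S ℤ.* (S ℤ.- + 1)) ≡
        (+ 1 ℤ.+ N) ℤ.* (+ 1 ℤ.+ N ℤ.+ + 1) ℤ.* (+ 1 ℤ.+ N ℤ.+ + 3 ℤ.* S ℤ.- + 1) ℤ.+ + 6 ℤ.* S ℤ.* (S ℤ.- + 1)
      polynomial = ℤSolver.solve-∀

  -- With at least two path nodes the path block of the closed form already reduces to a successor.
  totalDist≢0 : ∀ s n → Graph.totalDist (comet s (suc (suc n))) ≢ 0
  totalDist≢0 s n eq with () ← trans (sym (totalDist-comet s (suc n))) (cong (3 *_) eq)

open CometTotals

-- Contractions of comets

module CometContractions where

  open import Data.Nat using (ℕ; zero; suc; _+_; _∸_; _≤_; _<_; z≤n; s≤s; _<?_)
  open import Data.Nat.Properties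

  -- The quotient map of ℕ that collapses the interval [a, a + d] to a.
  squash : ℕ → ℕ → ℕ → ℕ
  squash zero    d k       = k ∸ d
  squash (suc a) d zero    = zero
  squash (suc a) d (suc k) = suc (squash a d k)

  squash-below : ∀ a d {k} → k ≤ a → squash a d k ≡ k
  squash-below zero    d z≤n       = 0∸n≡0 d
  squash-below (suc a) d z≤n       = refl
  squash-below (suc a) d (s≤s k≤a) = cong suc (squash-below a d k≤a)

  squash-above : ∀ a d {l} → a ≤ l → squash a d (l + d) ≡ l
  squash-above zero    d {l}     z≤n       = m+n∸n≡m l d
  squash-above (suc a) d {suc l} (s≤s a≤l) = cong suc (squash-above a d a≤l)

  squash-between : ∀ a d {k} → a ≤ k → k ≤ a + d → squash a d k ≡ a
  squash-between zero    d z≤n       k≤d       = m≤n⇒m∸n≡0 k≤d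
  squash-between (suc a) d (s≤s a≤k) (s≤s k≤) = cong suc (squash-between a d a≤k k≤)

  -- Consecutive heights stay consecutive or merge, which is what `hom` asks of an edge.
  squash-suc : ∀ a d k → squash a d (suc k) ≡ suc (squash a d k) ⊎ squash a d (suc k) ≡ squash a d k
  squash-suc zero d k with ≤-total d k
  ... | inj₁ d≤k = inj₁ (+-∸-assoc 1 d≤k)
  ... | inj₂ k≤d with m≤n⇒m<n∨m≡n k≤d
  ...   | inj₁ k<d  = inj₂ (trans (m≤n⇒m∸n≡0 k<d) (sym (m≤n⇒m∸n≡0 k≤d)))
  ...   | inj₂ refl = inj₁ (+-∸-assoc 1 (≤-refl {d}))
  squash-suc (suc a) d zero    = inj₁ (cong suc (squash-below a d z≤n))
  squash-suc (suc a) d (suc k) = Sum.map (cong suc) (cong suc) (squash-suc a d k)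

  squash-≤ : ∀ a d {k m} → a ≤ m → k ≤ m + d → squash a d k ≤ m
  squash-≤ zero    d {k} {m} _ k≤ = ≤-trans (∸-monoˡ-≤ d k≤) (≤-reflexive (m+n∸n≡m m d))
  squash-≤ (suc a) d {zero}  _         _         = z≤n
  squash-≤ (suc a) d {suc k} (s≤s a≤m) (s≤s k≤) = s≤s (squash-≤ a d a≤m k≤)

  squash-fibre : ∀ a d {k l} → squash a d k ≡ squash a d l →
    k ≡ l ⊎ (a ≤ k × k ≤ a + d) × (a ≤ l × l ≤ a + d)
  squash-fibre zero d {k} {l} eq with k ≤? d | l ≤? d
  ... | yes k≤d | yes l≤d = inj₂ ((z≤n , k≤d) , (z≤n , l≤d))
  ... | yes k≤d | no  l≰d = contradiction (trans (sym (m≤n⇒m∸n≡0 k≤d)) eq) (<⇒≢ (m<n⇒0<n∸m (≰⇒> l≰d)))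
  ... | no  k≰d | yes l≤d = contradiction (trans (sym (m≤n⇒m∸n≡0 l≤d)) (sym eq)) (<⇒≢ (m<n⇒0<n∸m (≰⇒> k≰d)))
  ... | no  k≰d | no  l≰d = inj₁ (∸-cancelʳ-≡ (≰⇒≥ k≰d) (≰⇒≥ l≰d) eq)
  squash-fibre (suc a) d {zero}  {zero}  eq = inj₁ refl
  squash-fibre (suc a) d {suc k} {suc l} eq = Sum.map (cong suc) (λ ((p , q) , (p′ , q′)) →
    (s≤s p , s≤s q) , (s≤s p′ , s≤s q′)) (squash-fibre a d (suc-injective eq))

  Within : ℕ → ℕ → ℕ → Set
  Within a d k = a ≤ k × k ≤ a + d

  -- Covers the contractions that collapse exactly the nodes with height in [a, a + d]. Heights
  -- determine the images of all nodes except the leaves, so ℓ says where the leaves go: to leaves,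
  -- or into the collapsed point when c is contracted.
  module SpineContraction
    {s n s′ n′ : ℕ} (a d : ℕ) (w : CometNode s (suc n)) (ℓ : Fin s → CometNode s′ (suc n′))
    (a≤n′ : a ≤ n′) (n≤n′+d : n ≤ n′ + d)
    (replaced⇒within : ∀ {x} → Contraction.Replaced (comet s (suc n)) w x → Within a d (Height.height x))
    (within⇒replaced : ∀ {x} → Within a d (Height.height x) → Contraction.Replaced (comet s (suc n)) w x)
    (height-ℓ : ∀ j → Height.height (ℓ j) ≡ squash a d (suc n))
    (ℓ-fibre : ∀ {i j} → ℓ i ≡ ℓ j → i ≡ j ⊎ Within a d (suc n))
    (lift-spine : ∀ {l} → l < n′ → ∃ λ k → k < n × squash a d k ≡ l × squash a d (suc k) ≡ suc l)
    (lift-leaf : ∀ j′ → ∃ λ j → ℓ j ≡ u j′ × squash a d n ≡ n′)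
    where

    open Height
    open Contraction (comet s (suc n)) w using (Replaced)

    private
      module G = Graph (comet s (suc n))
      module H = Graph (comet s′ (suc n′))
      module EG = Comet s (suc n)
      module EH = Comet s′ (suc n′)
      p = squash a d

    π : G.Node → H.Node
    π (v i) = spine (p (toℕ i))
    π c     = spine (p n)
    π (u j) = ℓ j

    height-π : ∀ x → height (π x) ≡ p (height x)
    height-π (v i) = height-spine (squash-≤ a d a≤n′ (≤-trans (<⇒≤ (Fin.toℕ<n i)) n≤n′+d))
    height-π c     = height-spine (squash-≤ a d a≤n′ n≤n′+d)
    height-π (u j) = height-ℓ j

    π≡ : ∀ x {b} → height b ≤ n′ → p (height x) ≡ height b → π x ≡ b
    π≡ x b≤n′ eq = sym (height-injective b≤n′ (sym (trans (height-π x) eq)))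

    collapse : ∀ {x} → Replaced x → π x ≡ π w
    collapse {x} r = π≡ x (≤-trans (≤-reflexive hπw) a≤n′) (trans (to-a r) (sym hπw))
      where
      to-a : ∀ {y} → Replaced y → p (height y) ≡ a
      to-a {y} r with lower , upper ← replaced⇒within r = squash-between a d {height y} lower upper
      hπw = trans (height-π w) (to-a (inj₁ refl))

    fibre-heights : ∀ {x y} → p (height x) ≡ p (height y) →
      height x ≡ height y ⊎ Replaced x × Replaced y
    fibre-heights eq = Sum.map₂ (λ (α , β) → within⇒replaced α , within⇒replaced β) (squash-fibre a d eq)

    fibre : ∀ {x y} → π x ≡ π y → x ≡ y ⊎ Replaced x × Replaced y
    fibre {x} {y} πx≡πy with fibre-heights {x} {y} (trans (sym (height-π x)) (trans (cong height πx≡πy) (height-π y)))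
    ... | inj₂ r = inj₂ r
    ... | inj₁ eq with x | y
    ...   | v i | _   = inj₁ (height-injective (<⇒≤ (Fin.toℕ<n i)) eq)
    ...   | c   | _   = inj₁ (height-injective ≤-refl eq)
    ...   | u i | v j = inj₁ (sym (height-injective (<⇒≤ (Fin.toℕ<n j)) (sym eq)))
    ...   | u i | c   = inj₁ (sym (height-injective ≤-refl (sym eq)))
    -- Two leaves are the only nodes that equal heights do not identify.
    ...   | u i | u j = Sum.map (cong u) (λ α → within⇒replaced α , within⇒replaced α) (ℓ-fibre πx≡πy)

    hom-edge : ∀ {x y} → EG.Edge x y → EH.Edge (π x) (π y) ⊎ π x ≡ π y
    hom-edge {x} {y} e with squash-suc a d (height x)
    ... | inj₁ eq = inj₁ (edge (trans (height-π y)
                      (trans (cong p (height-edge e)) (trans eq (cong suc (sym (height-π x)))))))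
    ... | inj₂ eq with fibre-heights {x} {y} (trans (sym eq) (cong p (sym (height-edge e))))
    ...   | inj₁ level     = contradiction (trans level (height-edge e)) (<⇒≢ ≤-refl)
    ...   | inj₂ (rx , ry) = inj₂ (trans (collapse rx) (sym (collapse ry)))

    hom : ∀ {x y} → x G.~ y → π x H.~ π y ⊎ π x ≡ π y
    hom (fwd e) = Sum.map fwd (λ eq → eq) (hom-edge e)
    hom (bwd e) = Sum.map bwd sym (hom-edge e)

    lift-spine-edge : ∀ {a b} → EH.Edge a b → height b ≤ n′ → ∃₂ λ x y → π x ≡ a × π y ≡ b × EG.Edge x y
    lift-spine-edge {a} {b} e b≤n′ with k , k<n , pk≡ , pk+1≡ ← lift-spine {height a} (subst (_≤ n′) (height-edge e) b≤n′)
      = spine k , spine (suc k)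
      , π≡ (spine k) (<⇒≤ (subst (_≤ n′) (height-edge e) b≤n′)) (trans (cong p (height-spine (<⇒≤ k<n))) pk≡)
      , π≡ (spine (suc k)) b≤n′ (trans (cong p (height-spine k<n)) (trans pk+1≡ (sym (height-edge e))))
      , edge (trans (height-spine k<n) (cong suc (sym (height-spine (<⇒≤ k<n)))))

    lift-edge : ∀ {a b} → EH.Edge a b → ∃₂ λ x y → π x ≡ a × π y ≡ b × EG.Edge x y
    lift-edge e@(EH.v-v {j = j} _) = lift-spine-edge e (<⇒≤ (Fin.toℕ<n j))
    lift-edge e@(EH.v-c _)         = lift-spine-edge e ≤-refl
    lift-edge (EH.c-u {j′}) with j , ℓj≡ , pn≡ ← lift-leaf j′ = c , u j , π≡ c ≤-refl pn≡ , ℓj≡ , EG.c-u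

    lift : ∀ {a b} → a H.~ b → ∃₂ λ x y → π x ≡ a × π y ≡ b × x G.~ y
    lift (fwd e) with x , y , πx≡ , πy≡ , e′ ← lift-edge e = x , y , πx≡ , πy≡ , fwd e′
    lift (bwd e) with x , y , πx≡ , πy≡ , e′ ← lift-edge e = y , x , πy≡ , πx≡ , bwd e′

    surjective-spine : ∀ b → height b ≤ n′ → ∃ λ x → π x ≡ b
    surjective-spine b b≤n′ with height b in eq | b≤n′
    ... | zero  | _ = spine 0 , π≡ (spine 0) (subst (_≤ n′) (sym eq) z≤n)
      (trans (cong p (height-spine {s} {n} z≤n)) (trans (squash-below a d z≤n) (sym eq)))
    -- A positive height is reached as the upper end of a lifted edge.
    ... | suc l | l<n′ with k , k<n , _ , pk+1≡ ← lift-spine l<n′ = spine (suc k)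
      , π≡ (spine (suc k)) (subst (_≤ n′) (sym eq) l<n′) (trans (cong p (height-spine k<n)) (trans pk+1≡ (sym eq)))

    surjective : ∀ b → ∃ λ x → π x ≡ b
    surjective (v i) = surjective-spine (v i) (<⇒≤ (Fin.toℕ<n i))
    surjective c     = surjective-spine c ≤-refl
    surjective (u j′) with j , ℓj≡ , _ ← lift-leaf j′ = u j , ℓj≡

    π-isContraction : IsContraction (comet s (suc n)) (comet s′ (suc n′)) w π
    π-isContraction = record
      { collapse = collapse ; fibre = fibre ; surjective = surjective ; hom = hom ; lift = lift }

  module _ {s n : ℕ} {w : CometNode s (suc n)} where
    open Height {s} {n}
    open Contraction (comet s (suc n)) w using (Replaced)

    replaced⇒near : ∀ {x} → Replaced x → height w ≤ suc (height x) × height x ≤ suc (height w)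
    replaced⇒near (inj₁ refl)    = n≤1+n _ , n≤1+n _
    replaced⇒near (inj₂ (fwd e)) = m≤n⇒m≤1+n (<⇒≤ (≤-reflexive (sym (height-edge e)))) , ≤-reflexive (height-edge e)
    replaced⇒near (inj₂ (bwd e)) = ≤-reflexive (height-edge e) , m≤n⇒m≤1+n (<⇒≤ (≤-reflexive (sym (height-edge e))))

    -- The closed neighbourhood of w is the set of nodes with height within one of its own. This
    -- fails if w is a leaf, because the other leaves have the same height, so leaves get a separate
    -- contraction map.
    near⇒replaced : height w ≤ n → ∀ {x} → height w ≤ suc (height x) → height x ≤ suc (height w) → Replaced x
    near⇒replaced w≤n {x} w≤ x≤ with m≤n⇒m<n∨m≡n w≤ | m≤n⇒m<n∨m≡n x≤
    ... | inj₂ w≡ | _       = inj₂ (bwd (edge w≡))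
    ... | inj₁ _  | inj₂ x≡ = inj₂ (fwd (edge x≡))
    ... | inj₁ w< | inj₁ x< = inj₁ (sym (height-injective w≤n (≤-antisym (≤-pred w<) (≤-pred x<))))

    module _ {a} (hw≡ : height w ≡ suc a) where

      replaced⇒within : ∀ {x} → Replaced x → Within a 2 (height x)
      replaced⇒within {x} r with w≤ , x≤ ← replaced⇒near r
        = ≤-pred (subst (_≤ suc (height x)) hw≡ w≤)
        , subst (height x ≤_) (trans (cong suc hw≡) (+-comm 2 a)) x≤

      within⇒replaced : height w ≤ n → ∀ {x} → Within a 2 (height x) → Replaced x
      within⇒replaced w≤n {x} (a≤ , ≤a+2) = near⇒replaced w≤n
        (subst (_≤ suc (height x)) (sym hw≡) (s≤s a≤))
        (subst (height x ≤_) (sym (trans (cong suc hw≡) (+-comm 2 a))) ≤a+2)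

  module _ {a d n′ : ℕ} (a≤n′ : a ≤ n′) where

    squash-lift : ∀ {l} → l < n′ → ∃ λ k → k < n′ + d × squash a d k ≡ l × squash a d (suc k) ≡ suc l
    squash-lift {l} l<n′ with l <? a
    ... | yes l<a = l , ≤-trans l<n′ (m≤m+n n′ d) , squash-below a d (<⇒≤ l<a) , squash-below a d l<a
    -- From a upwards lifts are shifted by d; for l = a the edge leaves the collapsed interval from
    -- its top.
    ... | no  l≮a = l + d , +-monoˡ-< d l<n′ , squash-above a d (≮⇒≥ l≮a)
                  , squash-above a d (m≤n⇒m≤1+n (≮⇒≥ l≮a))

  module KeepLeaves {s n n′} (a d : ℕ) (n≡n′+d : n ≡ n′ + d) (a≤n′ : a ≤ n′) (w : CometNode s (suc n))
    (replaced⇒within : ∀ {x} → Contraction.Replaced (comet s (suc n)) w x → Within a d (Height.height x))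
    (within⇒replaced : ∀ {x} → Within a d (Height.height x) → Contraction.Replaced (comet s (suc n)) w x) where

    contract≅ : contract (comet s (suc n)) w ≅ comet s (suc n′)
    contract≅ = contract-≅ (SpineContraction.π-isContraction {n′ = n′} a d w u a≤n′ (≤-reflexive n≡n′+d)
      (λ {x} → replaced⇒within {x}) (λ {x} → within⇒replaced {x})
      (λ _ → sym (trans (cong (squash a d ∘ suc) n≡n′+d) (squash-above a d (m≤n⇒m≤1+n a≤n′))))
      (λ { refl → inj₁ refl })
      (λ {l} l<n′ → subst (λ m → ∃ λ k → k < m × squash a d k ≡ l × squash a d (suc k) ≡ suc l)
        (sym n≡n′+d) (squash-lift a≤n′ l<n′))
      (λ j → j , refl , trans (cong (squash a d) n≡n′+d) (squash-above a d a≤n′)))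

  -- The node at height 0 has no lower neighbour, so the collapsed interval is [0, 1].
  contract-end : ∀ {s n} i → number i ≡ 1 → contract (comet s (suc (suc n))) (v i) ≅ comet s (suc n)
  contract-end {s} {n} i i≡1 = KeepLeaves.contract≅ 0 1 (+-comm 1 n) z≤n (v i)
    (λ {x} r → z≤n , subst (height x ≤_) i≡1 (proj₂ (replaced⇒near r)))
    (λ {x} (_ , x≤1) → near⇒replaced (subst (_≤ suc n) (sym i≡0) z≤n)
      (subst (_≤ suc (height x)) (sym i≡0) z≤n) (subst (height x ≤_) (sym i≡1) x≤1))
    where
    open Height {s} {suc n}
    i≡0 = suc-injective i≡1

  -- The interval is centred at the height of `v i`. For the last path node before c it ends at c,
  -- and the merged node becomes the new centre with all leaves still above it.
  contract-inner : ∀ {s n} i → 2 ≤ number i → contract (comet s (suc (suc (suc n)))) (v i) ≅ comet s (suc n)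
  contract-inner {s} {n} i 2≤i with toℕ i in eq | 2≤i
  ... | zero  | s≤s ()
  ... | suc a | _ = KeepLeaves.contract≅ a 2 (+-comm 2 n)
    (≤-pred (≤-pred (subst (_≤ suc (suc n)) (cong suc eq) (Fin.toℕ<n i)))) (v i)
    (replaced⇒within eq) (within⇒replaced eq (<⇒≤ (Fin.toℕ<n i)))

  contract-centre : ∀ {s n} → contract (comet s (suc (suc n))) c ≅ comet 0 (suc n)
  contract-centre {s} {n} = contract-≅ (SpineContraction.π-isContraction {n′ = n} n 2 c
    (λ _ → Height.spine n) ≤-refl (≤-trans (n≤1+n (suc n)) (≤-reflexive (+-comm 2 n)))
    (replaced⇒within refl) (within⇒replaced refl ≤-refl)
    (λ _ → trans (Height.height-spine {0} ≤-refl) (sym (squash-between n 2 (proj₁ top) (proj₂ top))))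
    -- The leaves lie at the top of the collapsed interval, so any two of them may share an image.
    (λ _ → inj₂ top)
    (λ {l} l<n → l , m<n⇒m<1+n l<n , squash-below n 2 (<⇒≤ l<n) , squash-below n 2 l<n)
    -- The target has no leaves, hence no leaf edge to lift.
    λ ())
    where
    top : Within n 2 (suc (suc n))
    top = m≤n⇒m≤1+n (n≤1+n n) , ≤-reflexive (+-comm 2 n)

  module LeafContraction {s t : ℕ} (j₀ : Fin (suc s)) where
    private
      module G = Graph (comet (suc s) t)
      module H = Graph (comet s t)
      module EG = Comet (suc s) t
      module EH = Comet s t
    open Contraction (comet (suc s) t) (u j₀) using (Replaced)

    -- Only `u j₀` merges with c; `punchOut` renumbers the remaining leaves without a gap.
    leaf : Fin (suc s) → H.Node
    leaf j with j₀ Fin.≟ j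
    ... | yes _    = c
    ... | no  j₀≢j = u (punchOut j₀≢j)

    leaf-self : leaf j₀ ≡ c
    leaf-self with j₀ Fin.≟ j₀
    ... | yes _  = refl
    ... | no  ≢j = contradiction refl ≢j

    leaf-punchIn : ∀ j → leaf (punchIn j₀ j) ≡ u j
    leaf-punchIn j with j₀ Fin.≟ punchIn j₀ j
    ... | yes eq = contradiction (sym eq) (Fin.punchInᵢ≢i j₀ j)
    ... | no  ≢j = cong u (trans (Fin.punchOut-cong j₀ refl) (Fin.punchOut-punchIn j₀))

    π : G.Node → H.Node
    π (v i) = v i
    π c     = c
    π (u j) = leaf j

    hom-edge : ∀ {x y} → EG.Edge x y → EH.Edge (π x) (π y) ⊎ π x ≡ π y
    hom-edge (EG.v-v eq) = inj₁ (EH.v-v eq)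
    hom-edge (EG.v-c eq) = inj₁ (EH.v-c eq)
    hom-edge (EG.c-u {j}) with j₀ Fin.≟ j
    ... | yes _ = inj₂ refl
    ... | no  _ = inj₁ EH.c-u

    lift-edge : ∀ {a b} → EH.Edge a b → ∃₂ λ x y → π x ≡ a × π y ≡ b × EG.Edge x y
    lift-edge (EH.v-v eq)  = _ , _ , refl , refl , EG.v-v eq
    lift-edge (EH.v-c eq)  = _ , _ , refl , refl , EG.v-c eq
    lift-edge (EH.c-u {j}) = _ , u (punchIn j₀ j) , refl , leaf-punchIn j , EG.c-u

    π≡c⇒replaced : ∀ {x} → π x ≡ c → Replaced x
    π≡c⇒replaced {c} _ = inj₂ (bwd EG.c-u)
    π≡c⇒replaced {u j} eq with j₀ Fin.≟ j
    ... | yes refl = inj₁ refl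

    π-injective : ∀ {x y} → π x ≢ c → π x ≡ π y → x ≡ y
    π-injective {v i} {v .i} _ refl = refl
    π-injective {v i} {u j}  _ eq with j₀ Fin.≟ j
    π-injective {v i} {u j}  _ () | yes _
    π-injective {v i} {u j}  _ () | no _
    π-injective {c}          ≢c _ = contradiction refl ≢c
    π-injective {u i} {y}    ≢c eq with j₀ Fin.≟ i
    ... | yes _ = contradiction refl ≢c
    π-injective {u i} {u j}  ≢c eq | no j₀≢i with j₀ Fin.≟ j
    ... | no j₀≢j = cong u (Fin.punchOut-injective j₀≢i j₀≢j (u-injective eq))
      where
      u-injective : ∀ {i j} → CometNode.u {s} {t} i ≡ u j → i ≡ j
      u-injective refl = refl

    collapse : ∀ {x} → Replaced x → π x ≡ π (u j₀)
    collapse (inj₁ refl)          = refl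
    collapse (inj₂ (bwd EG.c-u)) = sym leaf-self

    contract-leaf : contract (comet (suc s) t) (u j₀) ≅ comet s t
    contract-leaf = contract-≅ record
      { collapse   = collapse
      ; fibre      = fibre
      ; surjective = surjective
      ; hom        = λ { (fwd e) → Sum.map fwd (λ eq → eq) (hom-edge e)
                       ; (bwd e) → Sum.map bwd sym (hom-edge e) }
      ; lift       = lift
      }
      where
      fibre : ∀ {x y} → π x ≡ π y → x ≡ y ⊎ Replaced x × Replaced y
      fibre {x} eq with π x H.≟ c
      ... | yes πx≡c = inj₂ (π≡c⇒replaced πx≡c , π≡c⇒replaced (trans (sym eq) πx≡c))
      ... | no  πx≢c = inj₁ (π-injective πx≢c eq)

      surjective : ∀ b → ∃ λ x → π x ≡ b
      surjective (v i) = v i , refl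
      surjective c     = c , refl
      surjective (u j) = u (punchIn j₀ j) , leaf-punchIn j

      lift : ∀ {a b} → a H.~ b → ∃₂ λ x y → π x ≡ a × π y ≡ b × x G.~ y
      lift (fwd e) with x , y , πx≡ , πy≡ , e′ ← lift-edge e = x , y , πx≡ , πy≡ , fwd e′
      lift (bwd e) with x , y , πx≡ , πy≡ , e′ ← lift-edge e = y , x , πy≡ , πx≡ , bwd e′

open CometContractions

-- Agglomeration and the four formulas

module Importance where

  open import Data.Integer using (ℤ; +_; 0ℤ; _+_; _-_; _*_)
  open import Data.Nat using (suc)
  open import Data.Rational using (1ℚ)

  if-no : ∀ {A P : Set} {x y : A} (P? : Dec P) → ¬ P → (if does P? then x else y) ≡ y
  if-no (yes p) ¬p = contradiction p ¬p
  if-no (no _)  _  = refl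

  φ-connected : ∀ G {m d} → Graph.order G ≡ m → m ≢ 1 → Graph.totalDist G ≡ d → φ G ≡ (+ m - + 1) // + d
  φ-connected G refl m≢1 refl = if-no (Graph.order G ℕ.≟ 1) m≢1

  -- Serves both the comet itself, through `≅-refl`, and its contractions. Two path nodes keep the
  -- order away from 1, where φ has its special value.
  φ-≅ : ∀ G s n → G ≅ comet s (suc (suc n)) →
    φ G ≡ (+ s + + suc (suc n) - + 1) // + Graph.totalDist (comet s (suc (suc n)))
  φ-≅ G s n G≅ = φ-connected G
    (trans (order-≅ G≅) (trans (order-comet s (suc n)) (ℕ.+-comm (suc (suc n)) s)))
    (λ eq → contradiction (trans (ℕ.+-comm (suc (suc n)) s) eq) λ ())
    (totalDist-≅ G≅ (Height.δ-isMetric {s} {suc n}))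

  ≅-refl : ∀ {G} → G ≅ G
  ≅-refl {G} = record
    { to         = λ x → x
    ; injective  = λ eq → eq
    ; surjective = λ x → x , refl
    ; preserves  = λ e → e
    ; reflects   = λ e → e
    }

  *≢0 : ∀ {i j} → i ≢ 0ℤ → j ≢ 0ℤ → i * j ≢ 0ℤ
  *≢0 {i} i≢0 j≢0 ij≡0 with ℤ.i*j≡0⇒i≡0∨j≡0 i ij≡0
  ... | inj₁ i≡0 = i≢0 i≡0
  ... | inj₂ j≡0 = j≢0 j≡0

  totalDistℤ≢0 : ∀ s n → + Graph.totalDist (comet s (suc (suc n))) ≢ 0ℤ
  totalDistℤ≢0 s n eq = totalDist≢0 s n (ℤ.+-injective eq)

  order-1≢0 : ∀ s n → + s + + suc (suc n) - + 1 ≢ 0ℤ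
  order-1≢0 s n eq = contradiction (ℤ.+-injective (trans (sym (lemma (+ s) (+ n))) eq)) λ ()
    where
    lemma : ∀ S N → S + (+ 2 + N) - + 1 ≡ + 1 + (S + N)
    lemma = ℤSolver.solve-∀

  -- N / M is 1 - (a / Δ) / (a′ / Δ′), up to a common factor q of numerator and denominator.
  record IsReduced (a Δ a′ Δ′ N M : ℤ) : Set where
    field
      q           : ℤ
      denominator : M * q ≡ Δ * a′
      numerator   : N * q + a * Δ′ ≡ Δ * a′

  one-minus-quotient-scaled : ∀ {a b a′ b′ Δ Δ′ N M} → + 3 * b ≡ Δ → + 3 * b′ ≡ Δ′ →
    b ≢ 0ℤ → a′ ≢ 0ℤ → b′ ≢ 0ℤ → IsReduced a Δ a′ Δ′ N M →
    1ℚ ℚ.- (a // b) ÷₀ (a′ // b′) ≡ N // M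
  one-minus-quotient-scaled {a} {b} {a′} {b′} {N = N} {M} refl refl b≢0 a′≢0 b′≢0 reduced =
    one-minus-quotient {a} {b} {a′} {b′} {N} {M} b≢0 a′≢0 b′≢0 M≢0
      -- After tripling, b and b′ occur only as 3b and 3b′, for which closed forms are known.
      (ℤ.*-cancelˡ-≡ (+ 3) _ _ (begin
        + 3 * (N * (b * a′) + a * b′ * M)        ≡⟨ left N b a′ a b′ M ⟩
        N * (+ 3 * b * a′) + a * (+ 3 * b′) * M  ≡⟨ cong (λ x → N * x + a * (+ 3 * b′) * M) denominator ⟨
        N * (M * q) + a * (+ 3 * b′) * M         ≡⟨ middle N M q (a * (+ 3 * b′)) ⟩
        (N * q + a * (+ 3 * b′)) * M             ≡⟨ cong (_* M) numerator ⟩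
        + 3 * b * a′ * M                         ≡⟨ right b a′ M ⟩
        + 3 * (b * a′ * M)                       ∎))
    where
    open ≡-Reasoning
    open IsReduced reduced
    -- M divides the nonzero product Δ a′, so the sign of the stated denominators need not be
    -- studied.
    M≢0 : M ≢ 0ℤ
    M≢0 M≡0 = *≢0 (*≢0 {+ 3} (λ ()) b≢0) a′≢0
      (trans (sym denominator) (trans (cong (_* q) M≡0) (ℤ.*-zeroˡ q)))
    left : ∀ N b a′ a b′ M → + 3 * (N * (b * a′) + a * b′ * M) ≡ N * (+ 3 * b * a′) + a * (+ 3 * b′) * M
    left = ℤSolver.solve-∀
    middle : ∀ N M q x → N * (M * q) + x * M ≡ (N * q + x) * M
    middle = ℤSolver.solve-∀
    right : ∀ b a′ M → + 3 * b * a′ * M ≡ + 3 * (b * a′ * M)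
    right = ℤSolver.solve-∀

  IMC-comet : ∀ s n s′ n′ {w N M} → contract (comet s (suc (suc n))) w ≅ comet s′ (suc (suc n′)) →
    IsReduced (+ s + + suc (suc n) - + 1)   (D (+ s) (+ suc (suc n)))
              (+ s′ + + suc (suc n′) - + 1) (D (+ s′) (+ suc (suc n′))) N M →
    IMC (comet s (suc (suc n))) w ≡ N // M
  IMC-comet s n s′ n′ {w} contract≅ reduced = trans
    (cong₂ (λ p q → 1ℚ ℚ.- p ÷₀ q) (φ-≅ (comet s (suc (suc n))) s n ≅-refl)
      (φ-≅ (contract (comet s (suc (suc n))) w) s′ n′ contract≅))
    (one-minus-quotient-scaled (3*totalDist≡D s (suc n)) (3*totalDist≡D s′ (suc n′))
      (totalDistℤ≢0 s n) (order-1≢0 s′ n′) (totalDistℤ≢0 s′ n′) reduced)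

  -- D is spelled out because the ring solver treats defined functions as atoms.
  end-reduced : ∀ S T →
    let D = λ S T → T * (T + + 1) * (T + + 3 * S - + 1) + + 6 * S * (S - + 1) in
    IsReduced (S + (+ 1 + T) - + 1) (D S (+ 1 + T)) (S + T - + 1) (D S T)
      (+ 2 * (+ 1 + T) * (+ 3 * (S * S) - + 6 * S + + 3 * S * (+ 1 + T) - + 3 * (+ 1 + T)
          + (+ 1 + T) * (+ 1 + T) + + 2)
        - + 6 * S * (S - + 1))
      (D S (+ 1 + T) * (S + (+ 1 + T) - + 2))
  end-reduced S T = record
    { q = + 1 ; denominator = ℤSolver.solve (S ∷ T ∷ []) ; numerator = ℤSolver.solve (S ∷ T ∷ []) }

  inner-reduced : ∀ S T →
    let D = λ S T → T * (T + + 1) * (T + + 3 * S - + 1) + + 6 * S * (S - + 1) in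
    IsReduced (S + (+ 2 + T) - + 1) (D S (+ 2 + T)) (S + T - + 1) (D S T)
      (+ 12 * S * (+ 2 + T) * (S + (+ 2 + T) - + 3) + + 2 * (+ 2 + T) * (+ 2 * (+ 2 + T) - + 5) * ((+ 2 + T) - + 2)
        - + 6 * (+ 3 * S - + 1) * (S - + 1))
      ((S + (+ 2 + T) - + 3) * D S (+ 2 + T))
  inner-reduced S T = record
    { q = + 1 ; denominator = ℤSolver.solve (S ∷ T ∷ []) ; numerator = ℤSolver.solve (S ∷ T ∷ []) }

  centre-reduced : ∀ S T →
    let D = λ S T → T * (T + + 1) * (T + + 3 * S - + 1) + + 6 * S * (S - + 1) in
    IsReduced (S + (+ 1 + T) - + 1) (D S (+ 1 + T)) (+ 0 + T - + 1) (D (+ 0) T)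
      (+ 2 * ((+ 1 + T) * (S * ((+ 1 + T) + + 2) + (+ 1 + T) - + 1) + + 3 * S * (S - + 1)))
      (D S (+ 1 + T))
  centre-reduced S T = record
    -- The contracted graph is a path of order T, so a′ is T - 1 and Δ′ is T (T + 1) (T - 1). Both
    -- contain T - 1, which the stated fraction has cancelled.
    { q = + 0 + T - + 1 ; denominator = ℤSolver.solve (S ∷ T ∷ []) ; numerator = ℤSolver.solve (S ∷ T ∷ []) }

  leaf-reduced : ∀ S T →
    let D = λ S T → T * (T + + 1) * (T + + 3 * S - + 1) + + 6 * S * (S - + 1) in
    IsReduced ((+ 1 + S) + T - + 1) (D (+ 1 + S) T) (S + T - + 1) (D S T)
      (+ 2 * T * (T * T + + 6 * (+ 1 + S) - + 7) + + 6 * ((+ 1 + S) - + 1) * ((+ 1 + S) - + 2))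
      (((+ 1 + S) + T - + 2) * D (+ 1 + S) T)
  leaf-reduced S T = record
    { q = + 1 ; denominator = ℤSolver.solve (S ∷ T ∷ []) ; numerator = ℤSolver.solve (S ∷ T ∷ []) }

open Importance

open import Data.Integer using (+_; _+_; _-_; _*_)
open import Data.Nat using (ℕ; _>_; _≤_; suc; s≤s)

theorem2p2p1 : ∀ (s t : ℕ) → s > 2 → t > 3 →
    let G = comet s t
        S = + s
        T = + t
        D = T * (T + + 1) * (T + + 3 * S - + 1) + + 6 * S * (S - + 1)
    in
      (∀ i → number i ≡ 1 →
        IMC G (v i) ≡
          (+ 2 * T * (+ 3 * (S * S) - + 6 * S + + 3 * S * T - + 3 * T + T * T + + 2)
            - + 6 * S * (S - + 1))
          // (D * (S + T - + 2)))
    × (∀ i → 2 ≤ number i →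
        IMC G (v i) ≡
          (+ 12 * S * T * (S + T - + 3) + + 2 * T * (+ 2 * T - + 5) * (T - + 2)
            - + 6 * (+ 3 * S - + 1) * (S - + 1))
          // ((S + T - + 3) * D))
    × (IMC G c ≡
          (+ 2 * (T * (S * (T + + 2) + T - + 1) + + 3 * S * (S - + 1)))
          // D)
    × (∀ j →
        IMC G (u j) ≡
          (+ 2 * T * (T * T + + 6 * S - + 7) + + 6 * (S - + 1) * (S - + 2))
          // ((S + T - + 2) * D))
-- Writing t as 4 + n leaves at least two path nodes even after t drops by 2, and `suc s` makes room
-- for losing a leaf. The reduction lemmas take the parameters of the contracted comet, so that sums
-- such as `+ 1 + T` compute to the original ones.
theorem2p2p1 (suc s) (suc (suc (suc (suc n)))) (s≤s _) (s≤s (s≤s (s≤s (s≤s _)))) =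
    (λ i i≡1 → IMC-comet (suc s) (2 ℕ.+ n) (suc s) (suc n) (contract-end i i≡1)
      (end-reduced (+ suc s) (+ (3 ℕ.+ n))))
  , (λ i 2≤i → IMC-comet (suc s) (2 ℕ.+ n) (suc s) n (contract-inner i 2≤i)
      (inner-reduced (+ suc s) (+ (2 ℕ.+ n))))
  , IMC-comet (suc s) (2 ℕ.+ n) 0 (suc n) contract-centre
      (centre-reduced (+ suc s) (+ (3 ℕ.+ n)))
  , (λ j → IMC-comet (suc s) (2 ℕ.+ n) s (2 ℕ.+ n) (LeafContraction.contract-leaf j)
      (leaf-reduced (+ s) (+ (4 ℕ.+ n))))
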